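{- Let $\mu\geq 3$ be an integer. Every $\mu$-way $(v,3,2)$ trade of minimum volume (i.e., whose volume equals the minimum volume of all $\mu$-way $(v',3,2)$ trades) is a Steiner trade.
   Context: A $(v,k,t)$ trade is a triple $(X;T_1,T_2)$ where $X$ is a $v$-set and $T_1,T_2$ are disjoint nonempty collections of $k$-subsets (blocks) of $X$ such that every $t$-subset of $X$ is contained in the same number of blocks of $T_1$ as of $T_2$. A $\mu$-way $(v,k,t)$ trade is a pair $T=(X,\{T_1,\dots,T_\mu\})$ such that for every $i\neq j$, $(X;T_i,T_j)$ is a $(v,k,t)$ trade. The volume of $T$ is the common number of blocks of the $T_i$. A $\mu$-way $(v,k,t)$ trade is a Steiner trade if every $t$-subset of $X$ is contained in at most one block of each $T_i$. -}

module Defs where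

open import Data.Nat using (ℕ; _≤_)
open import Data.Fin using (Fin)
open import Data.Fin.Subset using (Subset; ∣_∣)
open import Data.Fin.Subset.Properties using (_⊆?_)
open import Data.List using (List; []; length; filter)
open import Data.List.Relation.Unary.All using (All)
open import Data.List.Membership.Propositional using (_∈_)
open import Data.Empty using (⊥)
open import Data.Product using (_×_)
open import Relation.Binary.PropositionalEquality using (_≡_; _≢_)

-- The point set X is Fin v.  A block is a subset of Fin v; a collection of
-- blocks is a list (a multiset of blocks).

count : {v : ℕ} → Subset v → List (Subset v) → ℕ
count s C = length (filter (λ B → s ⊆? B) C)

IsKCollection : (v k : ℕ) → List (Subset v) → Set
IsKCollection v k C = All (λ B → ∣ B ∣ ≡ k) C

Disjoint : {v : ℕ} → List (Subset v) → List (Subset v) → Set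
Disjoint {v} C D = (B : Subset v) → B ∈ C → B ∈ D → ⊥

IsTrade : (v k t : ℕ) → List (Subset v) → List (Subset v) → Set
IsTrade v k t C D =
  IsKCollection v k C × IsKCollection v k D × C ≢ [] × D ≢ [] × Disjoint C D ×
  ((s : Subset v) → ∣ s ∣ ≡ t → count s C ≡ count s D)

IsMuWayTrade : (μ v k t : ℕ) → (Fin μ → List (Subset v)) → Set
IsMuWayTrade μ v k t T = (i j : Fin μ) → i ≢ j → IsTrade v k t (T i) (T j)

IsSteiner : (μ v t : ℕ) → (Fin μ → List (Subset v)) → Set
IsSteiner μ v t T = (i : Fin μ) (s : Subset v) → ∣ s ∣ ≡ t → count s (T i) ≤ 1

-- the volume of T (number of blocks of T i, all equal for a trade) is at most
-- the volume of every μ-way (v',k,t) trade, for every v'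
HasMinimumVolume : (μ v k t : ℕ) → (Fin μ → List (Subset v)) → Set
HasMinimumVolume μ v k t T =
  (v' : ℕ) (T' : Fin μ → List (Subset v')) → IsMuWayTrade μ v' k t T' →
  (i j : Fin μ) → length (T i) ≤ length (T' j)

{-# OPTIONS --safe #-}
module Submission where

-- Write λ(x,y) for the number of blocks through x and y, r(x) for the number through x, and b for
-- the volume.  The blocks through x, y in the different T_i have different third points z, and those
-- through x, y, z number at most λ(x,z); summing over z gives (μ+1) λ(x,y) ≤ 2 r(x).  Summing
-- this in turn over all points gives (μ+2) 2 r(x) ≤ 6 b, so (μ+1)(μ+2) λ(x,y) ≤ 6 b, and a trade that
-- is not Steiner has 3 b ≥ (μ+1)(μ+2).
--
-- Smaller trades exist for every μ ≥ 3.  A w-way trade of volume V turns into a wg-way trade of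
-- volume V g² when every block {p,q,r} is replaced by the blocks {(p,a),(q,b),(r,c)} with
-- a + b + c ≡ s (mod g), one collection for each s.  Applied to the large set of seven Steiner triple
-- systems of order 9 this is good enough for all μ ≥ 23; four further cyclic trades do the rest.

open import Defs
open import Data.Bool using (true; false; if_then_else_)
open import Data.Empty using (⊥-elim)
open import Data.Fin using (Fin; zero; suc; toℕ; fromℕ<)
import Data.Fin.Properties as Fin
open import Data.Fin.Properties using (toℕ-fromℕ<; toℕ-injective; toℕ<n)
open import Data.Fin.Subset using (Subset; ∣_∣; ⁅_⁆; _∪_) renaming (_∈_ to _∈ₛ_; ⊥ to ∅)
open import Data.Fin.Subset.Properties using (_⊆?_; ∪-identityˡ; x∈⁅x⁆; x∈⁅y⁆⇒x≡y; x∈p∪q⁺; x∈p∪q⁻)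
open import Data.List using (List; []; _∷_; _++_; map; filter; concatMap; cartesianProduct; upTo; allFin; length)
open import Data.List.Membership.Propositional using (_∈_; find)
open import Data.List.Membership.Propositional.Properties using (∈-allFin; ∈-map⁻; ∈-concatMap⁻; ∈-filter⁻; ∈-cartesianProduct⁻; ∈-upTo⁻)
open import Data.List.Properties using (length-map; length-tabulate; length-upTo; map-++; map-applyUpTo; map-tabulate; map-upTo; map-∘; upTo-∷ʳ)
open import Data.List.Relation.Unary.All using (All)
import Data.List.Relation.Unary.All as All
open import Data.List.Relation.Unary.Any using (here; there)
open import Data.Nat using (ℕ; zero; suc; _+_; _*_; _∸_; _/_; _%_; _≤_; _<_; _≡ᵇ_; _<ᵇ_; _≟_; _≤?_; _<?_; z≤n; s≤s; NonZero; >-nonZero⁻¹)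
open import Data.Nat.DivMod
open import Data.Nat.Divisibility using (n∣m*n)
open import Data.Nat.ListAction using (sum)
open import Data.Nat.ListAction.Properties using (sum-++)
open import Data.Nat.Properties hiding (_≟_; _≤?_; _<?_)
open import Data.Nat.Tactic.RingSolver using (solve-∀)
open import Data.Product using (∃; ∃₂; _×_; _,_; proj₁; proj₂)
open import Data.Sum using (_⊎_; inj₁; inj₂)
open import Data.Vec using ([]; _∷_; lookup; tabulate)
open import Data.Vec.Properties using ([]=⇒lookup; lookup⇒[]=; lookup∘tabulate)
open import Function using (_∘_; id)
open import Relation.Binary.Definitions using (tri<; tri≈; tri>)
open import Relation.Binary.PropositionalEquality using (_≡_; _≢_; refl; sym; trans; cong; cong₂; subst; subst₂; module ≡-Reasoning)
open import Relation.Nullary using (¬_; Dec; yes; no; contradiction)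
open import Relation.Nullary.Decidable using (_×-dec_; _⊎-dec_; ¬?; toWitness)

private
  variable
    A B : Set

-- Finite sums

∑ : List A → (A → ℕ) → ℕ
∑ xs f = sum (map f xs)

∑-cong : ∀ (xs : List A) {f g} → (∀ {x} → x ∈ xs → f x ≡ g x) → ∑ xs f ≡ ∑ xs g
∑-cong []       eq = refl
∑-cong (x ∷ xs) eq = cong₂ _+_ (eq (here refl)) (∑-cong xs (eq ∘ there))

∑-ext : ∀ (xs : List A) {f g} → (∀ x → f x ≡ g x) → ∑ xs f ≡ ∑ xs g
∑-ext xs eq = ∑-cong xs (λ {x} _ → eq x)

∑-mono : ∀ (xs : List A) {f g} → (∀ x → f x ≤ g x) → ∑ xs f ≤ ∑ xs g
∑-mono []       le = z≤n
∑-mono (x ∷ xs) le = +-mono-≤ (le x) (∑-mono xs le)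

∑-+ : ∀ (xs : List A) f g → ∑ xs (λ x → f x + g x) ≡ ∑ xs f + ∑ xs g
∑-+ []       f g = refl
∑-+ (x ∷ xs) f g = begin
  f x + g x + ∑ xs (λ x → f x + g x)  ≡⟨ cong (f x + g x +_) (∑-+ xs f g) ⟩
  f x + g x + (∑ xs f + ∑ xs g)       ≡⟨ interchange (f x) (g x) _ _ ⟩
  f x + ∑ xs f + (g x + ∑ xs g)       ∎
  where
  open ≡-Reasoning
  interchange : ∀ a b c d → a + b + (c + d) ≡ a + c + (b + d)
  interchange = solve-∀

∑-*ˡ : ∀ c (xs : List A) f → ∑ xs (λ x → c * f x) ≡ c * ∑ xs f
∑-*ˡ c []       f = sym (*-zeroʳ c)
∑-*ˡ c (x ∷ xs) f = trans (cong (c * f x +_) (∑-*ˡ c xs f)) (sym (*-distribˡ-+ c (f x) (∑ xs f)))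

∑-*ʳ : ∀ c (xs : List A) f → ∑ xs (λ x → f x * c) ≡ ∑ xs f * c
∑-*ʳ c xs f = trans (∑-ext xs (λ x → *-comm (f x) c)) (trans (∑-*ˡ c xs f) (*-comm c _))

∑-const : ∀ (xs : List A) c → ∑ xs (λ _ → c) ≡ length xs * c
∑-const []       c = refl
∑-const (x ∷ xs) c = cong (c +_) (∑-const xs c)

∑-0 : ∀ (xs : List A) → ∑ xs (λ _ → 0) ≡ 0
∑-0 xs = trans (∑-const xs 0) (*-zeroʳ (length xs))

∑-swap : ∀ (xs : List A) (ys : List B) (f : A → B → ℕ) →
  ∑ xs (λ x → ∑ ys (f x)) ≡ ∑ ys (λ y → ∑ xs (λ x → f x y))
∑-swap []       ys f = sym (∑-0 ys)
∑-swap (x ∷ xs) ys f = trans (cong (∑ ys (f x) +_) (∑-swap xs ys f)) (sym (∑-+ ys (f x) _))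

-- A strict inequality at one entry would make the sums strictly unequal. For 0-1 functions this
-- says that an inclusion between sets of equal size is an equality, which is how blocks sharing
-- three points get identified.
∑-≤-antisym : ∀ (xs : List A) {f g} → (∀ x → f x ≤ g x) → ∑ xs g ≤ ∑ xs f →
  ∀ {x} → x ∈ xs → f x ≡ g x
∑-≤-antisym (x ∷ xs) {f} {g} le ge (here refl) = ≤-antisym (le x)
  (+-cancelʳ-≤ (∑ xs f) _ _ (≤-trans (+-monoʳ-≤ (g x) (∑-mono xs le)) ge))
∑-≤-antisym (x ∷ xs) {f} {g} le ge (there x∈) = ∑-≤-antisym xs le
  (+-cancelˡ-≤ (f x) _ _ (≤-trans (+-monoˡ-≤ (∑ xs g) (le x)) ge)) x∈

∑≢0⇒∃ : ∀ (xs : List A) f → ∑ xs f ≢ 0 → ∃ λ x → x ∈ xs × f x ≢ 0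
∑≢0⇒∃ []       f ≢0 = contradiction refl ≢0
∑≢0⇒∃ (x ∷ xs) f ≢0 with f x ≟ 0
... | no  fx≢0 = x , here refl , fx≢0
... | yes fx≡0 with ∑≢0⇒∃ xs f (λ eq → ≢0 (cong₂ _+_ fx≡0 eq))
...   | y , y∈xs , fy≢0 = y , there y∈xs , fy≢0

∑-map : ∀ (h : A → B) xs f → ∑ (map h xs) f ≡ ∑ xs (f ∘ h)
∑-map h xs f = cong sum (sym (map-∘ xs))

∑-++ : ∀ (xs ys : List A) f → ∑ (xs ++ ys) f ≡ ∑ xs f + ∑ ys f
∑-++ xs ys f = trans (cong sum (map-++ f xs ys)) (sum-++ (map f xs) (map f ys))

∑-concatMap : ∀ (h : A → List B) xs f → ∑ (concatMap h xs) f ≡ ∑ xs (λ x → ∑ (h x) f)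
∑-concatMap h []       f = refl
∑-concatMap h (x ∷ xs) f = trans (∑-++ (h x) (concatMap h xs) f) (cong (∑ (h x) f +_) (∑-concatMap h xs f))

∑-cartesianProduct : ∀ (xs : List A) (ys : List B) f →
  ∑ (cartesianProduct xs ys) f ≡ ∑ xs (λ x → ∑ ys (λ y → f (x , y)))
∑-cartesianProduct []       ys f = refl
∑-cartesianProduct (x ∷ xs) ys f = trans (∑-++ (map (x ,_) ys) (cartesianProduct xs ys) f)
  (cong₂ _+_ (∑-map (x ,_) ys f) (∑-cartesianProduct xs ys f))

length≡∑ : ∀ (xs : List A) → length xs ≡ ∑ xs (λ _ → 1)
length≡∑ xs = sym (trans (∑-const xs 1) (*-identityʳ (length xs)))

∑-allFin-suc : ∀ n (f : Fin (suc n) → ℕ) → ∑ (allFin (suc n)) f ≡ f zero + ∑ (allFin n) (f ∘ suc)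
∑-allFin-suc n f = cong (λ xs → f zero + sum xs)
  (trans (map-tabulate suc f) (sym (map-tabulate id (f ∘ suc))))

∑-upTo-suc : ∀ n f → ∑ (upTo (suc n)) f ≡ f 0 + ∑ (upTo n) (f ∘ suc)
∑-upTo-suc n f = cong (λ xs → f 0 + sum xs)
  (trans (map-applyUpTo suc f n) (sym (map-upTo (f ∘ suc) n)))

∑-upTo-toℕ : ∀ n f → ∑ (upTo n) f ≡ ∑ (allFin n) (f ∘ toℕ)
∑-upTo-toℕ zero    f = refl
∑-upTo-toℕ (suc n) f = begin
  ∑ (upTo (suc n)) f                          ≡⟨ ∑-upTo-suc n f ⟩
  f 0 + ∑ (upTo n) (f ∘ suc)                  ≡⟨ cong (f 0 +_) (∑-upTo-toℕ n (f ∘ suc)) ⟩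
  f 0 + ∑ (allFin n) (f ∘ suc ∘ toℕ)          ≡⟨ ∑-allFin-suc n (f ∘ toℕ) ⟨
  ∑ (allFin (suc n)) (f ∘ toℕ)                ∎
  where open ≡-Reasoning

-- Kronecker delta on the natural numbers

δ : ℕ → ℕ → ℕ
δ x y = if x ≡ᵇ y then 1 else 0

δ-refl : ∀ x → δ x x ≡ 1
δ-refl zero    = refl
δ-refl (suc x) = δ-refl x

δ-≢ : ∀ {x y} → x ≢ y → δ x y ≡ 0
δ-≢ {zero}  {zero}  x≢y = contradiction refl x≢y
δ-≢ {zero}  {suc y} x≢y = refl
δ-≢ {suc x} {zero}  x≢y = refl
δ-≢ {suc x} {suc y} x≢y = δ-≢ (x≢y ∘ cong suc)

δ-sym : ∀ x y → δ x y ≡ δ y x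
δ-sym zero    zero    = refl
δ-sym zero    (suc y) = refl
δ-sym (suc x) zero    = refl
δ-sym (suc x) (suc y) = δ-sym x y

∑-δ-Fin : ∀ {n} (x : Fin n) (f : Fin n → ℕ) → ∑ (allFin n) (λ y → δ (toℕ x) (toℕ y) * f y) ≡ f x
∑-δ-Fin {suc n} zero f = begin
  ∑ (allFin (suc n)) (λ y → δ 0 (toℕ y) * f y)  ≡⟨ ∑-allFin-suc n _ ⟩
  1 * f zero + ∑ (allFin n) (λ y → 0)           ≡⟨ cong₂ _+_ (*-identityˡ (f zero)) (∑-0 (allFin n)) ⟩
  f zero + 0                                    ≡⟨ +-identityʳ (f zero) ⟩
  f zero                                        ∎
  where open ≡-Reasoning
∑-δ-Fin {suc n} (suc x) f = trans (∑-allFin-suc n (λ y → δ (toℕ (suc x)) (toℕ y) * f y)) (∑-δ-Fin x (f ∘ suc))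

∑-δ : ∀ {n x} → x < n → (f : ℕ → ℕ) → ∑ (upTo n) (λ y → δ x y * f y) ≡ f x
∑-δ {n} {x} x<n f = begin
  ∑ (upTo n) (λ y → δ x y * f y)                                      ≡⟨ ∑-upTo-toℕ n _ ⟩
  ∑ (allFin n) (λ y → δ x (toℕ y) * f (toℕ y))                        ≡⟨ cong (λ z → ∑ (allFin n) (λ y → δ z (toℕ y) * f (toℕ y))) (toℕ-fromℕ< x<n) ⟨
  ∑ (allFin n) (λ y → δ (toℕ (fromℕ< x<n)) (toℕ y) * f (toℕ y))       ≡⟨ ∑-δ-Fin (fromℕ< x<n) (f ∘ toℕ) ⟩
  f (toℕ (fromℕ< x<n))                                                ≡⟨ cong f (toℕ-fromℕ< x<n) ⟩
  f x                                                                 ∎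
  where open ≡-Reasoning

∑-δ-filter : ∀ (xs : List A) (h : A → ℕ) s f →
  ∑ (filter (λ x → h x ≟ s) xs) f ≡ ∑ xs (λ x → δ (h x) s * f x)
∑-δ-filter []       h s f = refl
-- The Boolean `h x ≡ᵇ s` decides both `h x ≟ s` and `δ`, so one case split reduces both sides.
∑-δ-filter (x ∷ xs) h s f with h x ≡ᵇ s
... | true  = cong₂ _+_ (sym (*-identityˡ (f x))) (∑-δ-filter xs h s f)
... | false = ∑-δ-filter xs h s f

∑-upTo-last : ∀ n f → ∑ (upTo (suc n)) f ≡ ∑ (upTo n) f + f n
∑-upTo-last n f = begin
  ∑ (upTo (suc n)) f            ≡⟨ cong (λ xs → ∑ xs f) (upTo-∷ʳ n) ⟨
  ∑ (upTo n ++ n ∷ []) f        ≡⟨ ∑-++ (upTo n) (n ∷ []) f ⟩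
  ∑ (upTo n) f + (f n + 0)      ≡⟨ cong (∑ (upTo n) f +_) (+-identityʳ (f n)) ⟩
  ∑ (upTo n) f + f n            ∎
  where open ≡-Reasoning

-- This turns disjointness into an inequality: a fixed triple is a block in at most one of the ways,
-- so its multiplicities summed over all ways still obey the bound valid for a single way.
∑-atMostOne : ∀ {n} (f : Fin n → ℕ) {b} → (∀ i → f i ≤ b) →
  (∀ i j → i ≢ j → f i ≢ 0 → f j ≡ 0) → ∑ (allFin n) f ≤ b
∑-atMostOne {zero}  f f≤b one = z≤n
∑-atMostOne {suc n} f {b} f≤b one with f zero ≟ 0
... | yes f0≡0 = subst (_≤ b) (sym (trans (∑-allFin-suc n f) (cong (_+ ∑ (allFin n) (f ∘ suc)) f0≡0)))
  (∑-atMostOne (f ∘ suc) (f≤b ∘ suc) (λ i j i≢j → one (suc i) (suc j) (λ { refl → i≢j refl })))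
... | no  f0≢0 = subst (_≤ b) (sym (begin
  ∑ (allFin (suc n)) f               ≡⟨ ∑-allFin-suc n f ⟩
  f zero + ∑ (allFin n) (f ∘ suc)    ≡⟨ cong (f zero +_) (∑-ext (allFin n) (λ i → one zero (suc i) (λ ()) f0≢0)) ⟩
  f zero + ∑ (allFin n) (λ _ → 0)    ≡⟨ cong (f zero +_) (∑-0 (allFin n)) ⟩
  f zero + 0                         ≡⟨ +-identityʳ (f zero) ⟩
  f zero                             ∎)) (f≤b zero)
  where open ≡-Reasoning

-- Indicator functions of subsets

ind : ∀ {v} → Subset v → Fin v → ℕ
ind B x = if lookup B x then 1 else 0

ind-∈ : ∀ {v} {B : Subset v} {x} → x ∈ₛ B → ind B x ≡ 1
ind-∈ x∈B = cong (if_then 1 else 0) ([]=⇒lookup x∈B)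

ind-∉ : ∀ {v} {B : Subset v} {x} → ¬ x ∈ₛ B → ind B x ≡ 0
ind-∉ {B = B} {x} x∉B with lookup B x in eq
... | true  = contradiction (lookup⇒[]= x B eq) x∉B
... | false = refl

ind-idem : ∀ {v} (B : Subset v) x → ind B x * ind B x ≡ ind B x
ind-idem B x with lookup B x
... | true  = refl
... | false = refl

ind-injective : ∀ {v} (B B′ : Subset v) → (∀ x → ind B x ≡ ind B′ x) → B ≡ B′
ind-injective []            []              eq = refl
ind-injective (true  ∷ B) (true  ∷ B′) eq = cong (true ∷_) (ind-injective B B′ (eq ∘ suc))
ind-injective (false ∷ B) (false ∷ B′) eq = cong (false ∷_) (ind-injective B B′ (eq ∘ suc))
ind-injective (true  ∷ B) (false ∷ B′) eq = contradiction (eq zero) λ ()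
ind-injective (false ∷ B) (true  ∷ B′) eq = contradiction (eq zero) λ ()

∑-ind : ∀ {v} (B : Subset v) → ∑ (allFin v) (ind B) ≡ ∣ B ∣
∑-ind []          = refl
∑-ind (true  ∷ B) = trans (∑-allFin-suc _ (ind (true ∷ B))) (cong suc (∑-ind B))
∑-ind (false ∷ B) = trans (∑-allFin-suc _ (ind (false ∷ B))) (∑-ind B)

∣s∣≡0⇒empty : ∀ {v} (s : Subset v) → ∣ s ∣ ≡ 0 → s ≡ ∅
∣s∣≡0⇒empty []          eq = refl
∣s∣≡0⇒empty (false ∷ s) eq = cong (false ∷_) (∣s∣≡0⇒empty s eq)

∣s∣≡1⇒singleton : ∀ {v} (s : Subset v) → ∣ s ∣ ≡ 1 → ∃ λ x → s ≡ ⁅ x ⁆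
∣s∣≡1⇒singleton (true  ∷ s) eq = zero , cong (true ∷_) (∣s∣≡0⇒empty s (suc-injective eq))
∣s∣≡1⇒singleton (false ∷ s) eq with ∣s∣≡1⇒singleton s eq
... | x , refl = suc x , refl

∣s∣≡2⇒pair : ∀ {v} (s : Subset v) → ∣ s ∣ ≡ 2 → ∃₂ λ x y → x ≢ y × s ≡ ⁅ x ⁆ ∪ ⁅ y ⁆
∣s∣≡2⇒pair (true  ∷ s) eq with ∣s∣≡1⇒singleton s (suc-injective eq)
... | y , refl = zero , suc y , (λ ()) , cong (true ∷_) (sym (∪-identityˡ ⁅ y ⁆))
∣s∣≡2⇒pair (false ∷ s) eq with ∣s∣≡2⇒pair s eq
... | x , y , x≢y , refl = suc x , suc y , (λ { refl → x≢y refl }) , refl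

ind-pair : ∀ {v} {x y : Fin v} → x ≢ y → ∀ z → ind (⁅ x ⁆ ∪ ⁅ y ⁆) z ≡ δ (toℕ x) (toℕ z) + δ (toℕ y) (toℕ z)
ind-pair {x = x} {y} x≢y z with toℕ x ≟ toℕ z | toℕ y ≟ toℕ z
... | yes x≡z | yes y≡z = contradiction (toℕ-injective (trans x≡z (sym y≡z))) x≢y
... | yes x≡z | no  y≢z with refl ← toℕ-injective x≡z =
  trans (ind-∈ (x∈p∪q⁺ (inj₁ (x∈⁅x⁆ x)))) (sym (cong₂ _+_ (δ-refl (toℕ x)) (δ-≢ y≢z)))
... | no  x≢z | yes y≡z with refl ← toℕ-injective y≡z =
  trans (ind-∈ (x∈p∪q⁺ {p = ⁅ x ⁆} (inj₂ (x∈⁅x⁆ y)))) (sym (cong₂ _+_ (δ-≢ x≢z) (δ-refl (toℕ y))))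
... | no  x≢z | no  y≢z = trans (ind-∉ z∉) (sym (cong₂ _+_ (δ-≢ x≢z) (δ-≢ y≢z)))
  where
  z∉ : ¬ z ∈ₛ ⁅ x ⁆ ∪ ⁅ y ⁆
  z∉ z∈ with x∈p∪q⁻ ⁅ x ⁆ ⁅ y ⁆ z∈
  ... | inj₁ z∈x = x≢z (cong toℕ (sym (x∈⁅y⁆⇒x≡y x z∈x)))
  ... | inj₂ z∈y = y≢z (cong toℕ (sym (x∈⁅y⁆⇒x≡y y z∈y)))

∑-δ-1 : ∀ {n} (x : Fin n) → ∑ (allFin n) (λ y → δ (toℕ x) (toℕ y)) ≡ 1
∑-δ-1 {n} x = trans (∑-ext (allFin n) (λ y → sym (*-identityʳ (δ (toℕ x) (toℕ y))))) (∑-δ-Fin x (λ _ → 1))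

∣pair∣≡2 : ∀ {v} {x y : Fin v} → x ≢ y → ∣ ⁅ x ⁆ ∪ ⁅ y ⁆ ∣ ≡ 2
∣pair∣≡2 {v} {x} {y} x≢y = begin
  ∣ ⁅ x ⁆ ∪ ⁅ y ⁆ ∣                                               ≡⟨ ∑-ind (⁅ x ⁆ ∪ ⁅ y ⁆) ⟨
  ∑ (allFin v) (ind (⁅ x ⁆ ∪ ⁅ y ⁆))                              ≡⟨ ∑-ext (allFin v) (ind-pair x≢y) ⟩
  ∑ (allFin v) (λ z → δ (toℕ x) (toℕ z) + δ (toℕ y) (toℕ z))      ≡⟨ ∑-+ (allFin v) _ _ ⟩
  _                                                               ≡⟨ cong₂ _+_ (∑-δ-1 x) (∑-δ-1 y) ⟩
  2                                                               ∎
  where open ≡-Reasoning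

-- Products of indicators replace the subset test of `count`, so that orders of summation can be
-- exchanged. On the diagonal the value is the degree of the point.
pairCount : ∀ {v} → List (Subset v) → Fin v → Fin v → ℕ
pairCount C x y = ∑ C (λ B → ind B x * ind B y)

pairCount-comm : ∀ {v} (C : List (Subset v)) x y → pairCount C x y ≡ pairCount C y x
pairCount-comm C x y = ∑-ext C (λ B → *-comm (ind B x) (ind B y))

count-pair : ∀ {v} (x y : Fin v) C → count (⁅ x ⁆ ∪ ⁅ y ⁆) C ≡ pairCount C x y
count-pair x y []      = refl
count-pair x y (B ∷ C) with (⁅ x ⁆ ∪ ⁅ y ⁆) ⊆? B
... | yes s⊆B = cong₂ _+_
  (sym (cong₂ _*_ (ind-∈ (s⊆B (x∈p∪q⁺ (inj₁ (x∈⁅x⁆ x))))) (ind-∈ (s⊆B (x∈p∪q⁺ {p = ⁅ x ⁆} (inj₂ (x∈⁅x⁆ y)))))))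
  (count-pair x y C)
... | no  s⊈B = cong₂ _+_ (sym zero-product) (count-pair x y C)
  where
  zero-product : ind B x * ind B y ≡ 0
  zero-product with lookup B x in eqx | lookup B y in eqy
  ... | false | _     = refl
  ... | true  | false = refl
  ... | true  | true  = ⊥-elim (s⊈B s⊆B)
    where
    s⊆B : ∀ {z} → z ∈ₛ ⁅ x ⁆ ∪ ⁅ y ⁆ → z ∈ₛ B
    s⊆B z∈ with x∈p∪q⁻ ⁅ x ⁆ ⁅ y ⁆ z∈
    ... | inj₁ z∈x = subst (_∈ₛ B) (sym (x∈⁅y⁆⇒x≡y x z∈x)) (lookup⇒[]= x B eqx)
    ... | inj₂ z∈y = subst (_∈ₛ B) (sym (x∈⁅y⁆⇒x≡y y z∈y)) (lookup⇒[]= y B eqy)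

-- The lower bound

tripleCount : ∀ {v} → List (Subset v) → Fin v → Fin v → Fin v → ℕ
tripleCount C x y z = ∑ C (λ B → ind B x * ind B y * ind B z)

*≢0⇒ : ∀ a b → a * b ≢ 0 → a ≢ 0 × b ≢ 0
*≢0⇒ a b ab≢0 = (λ { refl → ab≢0 refl }) , (λ { refl → ab≢0 (*-zeroʳ a) })

ind≤1 : ∀ {v} (B : Subset v) x → ind B x ≤ 1
ind≤1 B x with lookup B x
... | true  = s≤s z≤n
... | false = z≤n

ind≢0⇒≡1 : ∀ {v} (B : Subset v) x → ind B x ≢ 0 → ind B x ≡ 1
ind≢0⇒≡1 B x ≢0 with lookup B x
... | true  = refl
... | false = contradiction refl ≢0

-- The sum of the three deltas is at most `ind B`, since `x`, `y`, `z` are distinct points of `B`.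
-- Both functions have total 3, so they agree everywhere.
block-determined : ∀ {v} {x y z : Fin v} → x ≢ y → x ≢ z → y ≢ z → ∀ B → ∣ B ∣ ≡ 3 →
  ind B x * ind B y * ind B z ≢ 0 →
  ∀ w → δ (toℕ x) (toℕ w) + δ (toℕ y) (toℕ w) + δ (toℕ z) (toℕ w) ≡ ind B w
block-determined {v} {x} {y} {z} x≢y x≢z y≢z B ∣B∣≡3 xyz≢0 w =
  ∑-≤-antisym (allFin v) below (≤-reflexive (trans (trans (∑-ind B) ∣B∣≡3) (sym total))) (∈-allFin w)
  where
  open ≡-Reasoning
  xy≢0 = proj₁ (*≢0⇒ (ind B x * ind B y) (ind B z) xyz≢0)
  Bx = ind≢0⇒≡1 B x (proj₁ (*≢0⇒ (ind B x) (ind B y) xy≢0))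
  By = ind≢0⇒≡1 B y (proj₂ (*≢0⇒ (ind B x) (ind B y) xy≢0))
  Bz = ind≢0⇒≡1 B z (proj₂ (*≢0⇒ (ind B x * ind B y) (ind B z) xyz≢0))

  below : ∀ w → δ (toℕ x) (toℕ w) + δ (toℕ y) (toℕ w) + δ (toℕ z) (toℕ w) ≤ ind B w
  below w with x Fin.≟ w
  ... | yes refl rewrite δ-refl (toℕ x) | δ-≢ (x≢y ∘ sym ∘ toℕ-injective) | δ-≢ (x≢z ∘ sym ∘ toℕ-injective) = ≤-reflexive (sym Bx)
  ... | no x≢w with y Fin.≟ w
  ...   | yes refl rewrite δ-refl (toℕ y) | δ-≢ (x≢w ∘ toℕ-injective) | δ-≢ (y≢z ∘ sym ∘ toℕ-injective) = ≤-reflexive (sym By)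
  ...   | no y≢w with z Fin.≟ w
  ...     | yes refl rewrite δ-refl (toℕ z) | δ-≢ (x≢w ∘ toℕ-injective) | δ-≢ (y≢w ∘ toℕ-injective) = ≤-reflexive (sym Bz)
  ...     | no z≢w rewrite δ-≢ (x≢w ∘ toℕ-injective) | δ-≢ (y≢w ∘ toℕ-injective) | δ-≢ (z≢w ∘ toℕ-injective) = z≤n

  total : ∑ (allFin v) (λ w → δ (toℕ x) (toℕ w) + δ (toℕ y) (toℕ w) + δ (toℕ z) (toℕ w)) ≡ 3
  total = begin
    ∑ (allFin v) (λ w → δ (toℕ x) (toℕ w) + δ (toℕ y) (toℕ w) + δ (toℕ z) (toℕ w))
      ≡⟨ ∑-+ (allFin v) _ _ ⟩
    ∑ (allFin v) (λ w → δ (toℕ x) (toℕ w) + δ (toℕ y) (toℕ w)) + ∑ (allFin v) (λ w → δ (toℕ z) (toℕ w))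
      ≡⟨ cong₂ _+_ (∑-+ (allFin v) _ _) (∑-δ-1 z) ⟩
    ∑ (allFin v) (λ w → δ (toℕ x) (toℕ w)) + ∑ (allFin v) (λ w → δ (toℕ y) (toℕ w)) + 1
      ≡⟨ cong (_+ 1) (cong₂ _+_ (∑-δ-1 x) (∑-δ-1 y)) ⟩
    3 ∎

-- Correction terms concentrated at one point stand in for subtraction: the estimates below hold
-- only away from exceptional points, and suitable constants added there on both sides make them
-- hold everywhere.
∑-inclusion : ∀ {v} (x : Fin v) c (f : Fin v → ℕ) →
  ∑ (allFin v) (λ z → f z + δ (toℕ x) (toℕ z) * c) ≡ ∑ (allFin v) f + c
∑-inclusion {v} x c f = trans (∑-+ (allFin v) f _) (cong (∑ (allFin v) f +_) (∑-δ-Fin x (λ _ → c)))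

-- The way `i₀` serves as reference for pair counts, degrees and volume. Block sizes enter as a
-- separate hypothesis because `trade` speaks only of two distinct indices.
module LowerBound {μ v : ℕ} (T : Fin μ → List (Subset v)) (trade : IsMuWayTrade μ v 3 2 T)
  (blocks : ∀ i → All (λ B → ∣ B ∣ ≡ 3) (T i)) (i₀ : Fin μ) where

  open ≤-Reasoning

  private
    points : List (Fin v)
    points = allFin v

    ways : List (Fin μ)
    ways = allFin μ

  pairs : Fin v → Fin v → ℕ
  pairs = pairCount (T i₀)

  degree : Fin v → ℕ
  degree x = ∑ (T i₀) (λ B → ind B x)

  pairs-way : ∀ i {x y} → x ≢ y → pairCount (T i) x y ≡ pairs x y
  pairs-way i {x} {y} x≢y with i Fin.≟ i₀
  ... | yes refl = refl
  ... | no  i≢i₀ with trade i i₀ i≢i₀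
  ...   | _ , _ , _ , _ , _ , balanced = begin-equality
    pairCount (T i) x y            ≡⟨ count-pair x y (T i) ⟨
    count (⁅ x ⁆ ∪ ⁅ y ⁆) (T i)    ≡⟨ balanced (⁅ x ⁆ ∪ ⁅ y ⁆) (∣pair∣≡2 x≢y) ⟩
    count (⁅ x ⁆ ∪ ⁅ y ⁆) (T i₀)   ≡⟨ count-pair x y (T i₀) ⟩
    pairs x y                      ∎

  pairs-diagonal : ∀ x → pairs x x ≡ degree x
  pairs-diagonal x = ∑-ext (T i₀) (λ B → ind-idem B x)

  -- Double counting of incidences between points and blocks, weighted by `f`: each block has three
  -- points. The weights used later are `1`, `ind B x` and `ind B x * ind B y`.
  ∑-points : ∀ i (f : Subset v → ℕ) → ∑ points (λ z → ∑ (T i) (λ B → f B * ind B z)) ≡ ∑ (T i) f * 3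
  ∑-points i f = begin-equality
    ∑ points (λ z → ∑ (T i) (λ B → f B * ind B z))  ≡⟨ ∑-swap points (T i) _ ⟩
    ∑ (T i) (λ B → ∑ points (λ z → f B * ind B z))  ≡⟨ ∑-cong (T i) (λ {B} B∈ → trans (∑-*ˡ (f B) points (ind B)) (cong (f B *_) (trans (∑-ind B) (All.lookup (blocks i) B∈)))) ⟩
    ∑ (T i) (λ B → f B * 3)                         ≡⟨ ∑-*ʳ 3 (T i) f ⟩
    ∑ (T i) f * 3                                   ∎

  triples : Fin v → Fin v → Fin v → ℕ
  triples x y z = ∑ ways (λ i → tripleCount (T i) x y z)

  -- By disjointness at most one way has a block through all three points. In that way such blocks
  -- are among those through `x` and `z`, whose number is the same in every way.
  triples-≤-pairs : ∀ {x y z} → x ≢ y → x ≢ z → y ≢ z → triples x y z ≤ pairs x z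
  triples-≤-pairs {x} {y} {z} x≢y x≢z y≢z = ∑-atMostOne _ bound unique
    where
    bound : ∀ i → tripleCount (T i) x y z ≤ pairs x z
    bound i = begin
      tripleCount (T i) x y z   ≤⟨ ∑-mono (T i) (λ B → *-monoˡ-≤ (ind B z) (≤-trans (*-monoʳ-≤ (ind B x) (ind≤1 B y)) (≤-reflexive (*-identityʳ (ind B x))))) ⟩
      pairCount (T i) x z       ≡⟨ pairs-way i x≢z ⟩
      pairs x z                 ∎

    unique : ∀ i j → i ≢ j → tripleCount (T i) x y z ≢ 0 → tripleCount (T j) x y z ≡ 0
    unique i j i≢j i≢0 with tripleCount (T j) x y z ≟ 0
    ... | yes j≡0 = j≡0
    ... | no  j≢0 with trade i j i≢j | ∑≢0⇒∃ (T i) _ i≢0 | ∑≢0⇒∃ (T j) _ j≢0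
    ...   | _ , _ , _ , _ , disjoint , _ | B , B∈ , B≢0 | B′ , B′∈ , B′≢0 =
      ⊥-elim (disjoint B B∈ (subst (_∈ T j) (sym B≡B′) B′∈))
      where
      B≡B′ : B ≡ B′
      B≡B′ = ind-injective B B′ (λ w → trans
        (sym (block-determined x≢y x≢z y≢z B (All.lookup (blocks i) B∈) B≢0 w))
        (block-determined x≢y x≢z y≢z B′ (All.lookup (blocks j) B′∈) B′≢0 w))

  -- Indicators are idempotent, so for a repeated point the triple count collapses to a pair count,
  -- common to all `μ` ways.
  triples-endpointˡ : ∀ {x y} → x ≢ y → triples x y x ≡ μ * pairs x y
  triples-endpointˡ {x} {y} x≢y = begin-equality
    triples x y x                       ≡⟨ ∑-ext ways (λ i → trans (∑-ext (T i) (λ B → trans (rearrange (ind B x) (ind B y)) (cong (_* ind B y) (ind-idem B x)))) (pairs-way i x≢y)) ⟩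
    ∑ ways (λ _ → pairs x y)            ≡⟨ ∑-const ways (pairs x y) ⟩
    length ways * pairs x y             ≡⟨ cong (_* pairs x y) (length-tabulate {n = μ} id) ⟩
    μ * pairs x y                       ∎
    where
    rearrange : ∀ a b → a * b * a ≡ a * a * b
    rearrange = solve-∀

  triples-endpointʳ : ∀ {x y} → x ≢ y → triples x y y ≡ μ * pairs x y
  triples-endpointʳ {x} {y} x≢y = begin-equality
    triples x y y                       ≡⟨ ∑-ext ways (λ i → trans (∑-ext (T i) (λ B → trans (*-assoc (ind B x) (ind B y) (ind B y)) (cong (ind B x *_) (ind-idem B y)))) (pairs-way i x≢y)) ⟩
    ∑ ways (λ _ → pairs x y)            ≡⟨ ∑-const ways (pairs x y) ⟩
    length ways * pairs x y             ≡⟨ cong (_* pairs x y) (length-tabulate {n = μ} id) ⟩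
    μ * pairs x y                       ∎

  ∑-triples : ∀ {x y} → x ≢ y → ∑ points (triples x y) ≡ μ * (pairs x y * 3)
  ∑-triples {x} {y} x≢y = begin-equality
    ∑ points (triples x y)                                    ≡⟨ ∑-swap points ways _ ⟩
    ∑ ways (λ i → ∑ points (tripleCount (T i) x y))           ≡⟨ ∑-ext ways (λ i → trans (∑-points i (λ B → ind B x * ind B y)) (cong (_* 3) (pairs-way i x≢y))) ⟩
    ∑ ways (λ _ → pairs x y * 3)                              ≡⟨ ∑-const ways _ ⟩
    length ways * (pairs x y * 3)                             ≡⟨ cong (_* (pairs x y * 3)) (length-tabulate {n = μ} id) ⟩
    μ * (pairs x y * 3)                                       ∎

  -- Sum `triples-≤-pairs` over all `z` other than `x` and `y`. On the left the full sum `3 * μ * p`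
  -- loses `μ * p` at each endpoint, leaving `μ * p`. On the right the full sum `3 * r` loses `r` at
  -- `x` and `p` at `y`. Hence `μ * p + p ≤ 2 * r`.
  pairs-≤-degree : ∀ {x y} → x ≢ y → suc μ * pairs x y ≤ 2 * degree x
  -- The corrections are chosen to give equality at the endpoints: `μ * p + r` on both sides at
  -- `z = x`, and `μ * p + p` at `z = y`. The common amount `2 * (μ * p) + r` is cancelled at the
  -- end.
  pairs-≤-degree {x} {y} x≢y = +-cancelˡ-≤ (2 * (μ * p) + r) _ _ (begin
    2 * (μ * p) + r + suc μ * p        ≡⟨ left μ p r ⟩
    μ * (p * 3) + p + r                ≡⟨ cong (λ s → s + p + r) (∑-triples x≢y) ⟨
    ∑ points (triples x y) + p + r     ≡⟨ trans (∑-inclusion x r _) (cong (_+ r) (∑-inclusion y p (triples x y))) ⟨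
    ∑ points (λ z → triples x y z + δ (toℕ y) (toℕ z) * p + δ (toℕ x) (toℕ z) * r)
                                       ≤⟨ ∑-mono points pointwise ⟩
    ∑ points (λ z → pairs x z + δ (toℕ y) (toℕ z) * (μ * p) + δ (toℕ x) (toℕ z) * (μ * p))
                                       ≡⟨ trans (∑-inclusion x (μ * p) _) (cong (_+ μ * p) (∑-inclusion y (μ * p) (pairs x))) ⟩
    ∑ points (pairs x) + μ * p + μ * p ≡⟨ cong (λ s → s + μ * p + μ * p) (∑-points i₀ (λ B → ind B x)) ⟩
    r * 3 + μ * p + μ * p              ≡⟨ right (μ * p) r ⟩
    2 * (μ * p) + r + 2 * r            ∎)
    where
    p = pairs x y
    r = degree x
    left : ∀ μ p r → 2 * (μ * p) + r + (p + μ * p) ≡ μ * (p * 3) + p + r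
    left = solve-∀
    right : ∀ m r → r * 3 + m + m ≡ 2 * m + r + 2 * r
    right = solve-∀
    at-x : ∀ m p r → m + 0 * p + 1 * r ≡ r + 0 * m + 1 * m
    at-x = solve-∀
    at-y : ∀ m p r → m + 1 * p + 0 * r ≡ p + 1 * m + 0 * m
    at-y = solve-∀
    off : ∀ a b c → a + 0 * b + 0 * c ≡ a
    off = solve-∀
    pointwise : ∀ z → triples x y z + δ (toℕ y) (toℕ z) * p + δ (toℕ x) (toℕ z) * r
                    ≤ pairs x z + δ (toℕ y) (toℕ z) * (μ * p) + δ (toℕ x) (toℕ z) * (μ * p)
    pointwise z with x Fin.≟ z
    ... | yes refl rewrite δ-refl (toℕ x) | δ-≢ (x≢y ∘ sym ∘ toℕ-injective) | triples-endpointˡ x≢y | pairs-diagonal x =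
      ≤-reflexive (at-x (μ * p) p r)
    ... | no x≢z with y Fin.≟ z
    ...   | yes refl rewrite δ-refl (toℕ y) | δ-≢ (x≢y ∘ toℕ-injective) | triples-endpointʳ x≢y =
      ≤-reflexive (at-y (μ * p) p r)
    ...   | no y≢z rewrite δ-≢ (x≢z ∘ toℕ-injective) | δ-≢ (y≢z ∘ toℕ-injective) =
      subst₂ _≤_ (sym (off (triples x y z) p r)) (sym (off (pairs x z) (μ * p) (μ * p))) (triples-≤-pairs x≢y x≢z y≢z)

  ∑-degree : ∑ points degree ≡ length (T i₀) * 3
  ∑-degree = begin-equality
    ∑ points degree                                          ≡⟨ ∑-ext points (λ z → ∑-ext (T i₀) (λ B → sym (*-identityˡ (ind B z)))) ⟩
    ∑ points (λ z → ∑ (T i₀) (λ B → 1 * ind B z))            ≡⟨ ∑-points i₀ (λ _ → 1) ⟩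
    ∑ (T i₀) (λ _ → 1) * 3                                   ≡⟨ cong (_* 3) (trans (∑-const (T i₀) 1) (*-identityʳ (length (T i₀)))) ⟩
    length (T i₀) * 3                                        ∎

  -- Sum `pairs-≤-degree` over all `z` other than `x`. The pair counts at `x` then add up to `2 * r`
  -- and the degrees to three times the volume minus `r`, so `suc μ * (2 * r)` plus `2 * r` is at
  -- most six times the volume.
  degree-≤-volume : ∀ x → suc (suc μ) * (2 * degree x) ≤ 6 * length (T i₀)
  degree-≤-volume x = +-cancelˡ-≤ (suc μ * r) _ _ (begin
    suc μ * r + suc (suc μ) * (2 * r)    ≡⟨ left μ r ⟩
    suc μ * (r * 3) + 2 * r              ≡⟨ cong (λ s → suc μ * s + 2 * r) (∑-points i₀ (λ B → ind B x)) ⟨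
    suc μ * ∑ points (pairs x) + 2 * r   ≡⟨ trans (∑-inclusion x (2 * r) _) (cong (_+ 2 * r) (∑-*ˡ (suc μ) points (pairs x))) ⟨
    ∑ points (λ z → suc μ * pairs x z + δ (toℕ x) (toℕ z) * (2 * r))
                                         ≤⟨ ∑-mono points pointwise ⟩
    ∑ points (λ z → 2 * degree z + δ (toℕ x) (toℕ z) * (suc μ * r))
                                         ≡⟨ trans (∑-inclusion x (suc μ * r) _) (cong (_+ suc μ * r) (∑-*ˡ 2 points degree)) ⟩
    2 * ∑ points degree + suc μ * r      ≡⟨ cong (λ s → 2 * s + suc μ * r) ∑-degree ⟩
    2 * (length (T i₀) * 3) + suc μ * r  ≡⟨ right (suc μ * r) (length (T i₀)) ⟩
    suc μ * r + 6 * length (T i₀)        ∎)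
    where
    r = degree x
    left : ∀ μ r → suc μ * r + suc (suc μ) * (2 * r) ≡ suc μ * (r * 3) + 2 * r
    left = solve-∀
    right : ∀ m l → 2 * (l * 3) + m ≡ m + 6 * l
    right = solve-∀
    at-x : ∀ m r → m + 1 * (2 * r) ≡ 2 * r + 1 * m
    at-x = solve-∀
    pointwise : ∀ z → suc μ * pairs x z + δ (toℕ x) (toℕ z) * (2 * r) ≤ 2 * degree z + δ (toℕ x) (toℕ z) * (suc μ * r)
    pointwise z with x Fin.≟ z
    ... | yes refl rewrite δ-refl (toℕ x) | pairs-diagonal x = ≤-reflexive (at-x (suc μ * r) r)
    -- The pair is turned round because the bound wanted here is by the degree of `z`, the variable
    -- of summation.
    ... | no x≢z rewrite δ-≢ (x≢z ∘ toℕ-injective) | pairCount-comm (T i₀) x z =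
      +-monoˡ-≤ 0 (pairs-≤-degree (x≢z ∘ sym))

  pairs-≤-volume : ∀ {x y} → x ≢ y → suc (suc μ) * (suc μ * pairs x y) ≤ 6 * length (T i₀)
  pairs-≤-volume {x} x≢y = ≤-trans (*-monoʳ-≤ (suc (suc μ)) (pairs-≤-degree x≢y)) (degree-≤-volume x)

-- Trades whose blocks are triples of natural numbers

Triple : Set
Triple = ℕ × ℕ × ℕ

Inside : ℕ → Triple → Set
Inside v (p , q , r) = p < v × q < v × r < v

Distinct : Triple → Set
Distinct (p , q , r) = p ≢ q × p ≢ r × q ≢ r

In : ℕ → Triple → Set
In x (p , q , r) = x ≡ p ⊎ x ≡ q ⊎ x ≡ r

infix 4 _⊑_
-- Triples are ordered but blocks are not. For triples with distinct entries this one-sided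
-- inclusion already means that the underlying sets are equal.
_⊑_ : Triple → Triple → Set
(p , q , r) ⊑ t = In p t × In q t × In r t

∋ : Triple → ℕ → ℕ
∋ (p , q , r) x = δ p x + δ q x + δ r x

-- For distinct x and y, the indicator of {x, y} ⊆ t.
cross : ℕ → ℕ → Triple → ℕ
cross x y (p , q , r) =
  δ p x * δ q y + δ p x * δ r y + δ q x * δ p y + δ q x * δ r y + δ r x * δ p y + δ r x * δ q y

-- Numbers below `w` serve as indices so that inflation can split an index into quotient and
-- remainder. The field `balanced` covers `x = y` too, where `cross` vanishes on distinct triples:
-- two points of an inflated family may lie over the same base point.
record Family (w v V : ℕ) (F : ℕ → List Triple) : Set where
  field
    inside  : ∀ {i} → i < w → All (Inside v) (F i)
    distinct : ∀ {i} → i < w → All Distinct (F i)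
    balanced : ∀ {i j} → i < w → j < w → ∀ {x y} → x < v → y < v →
               ∑ (F i) (cross x y) ≡ ∑ (F j) (cross x y)
    disjoint : ∀ {i j} → i < w → j < w → i ≢ j → ∀ {t u} → t ∈ F i → u ∈ F j → ¬ t ⊑ u
    volume   : ∀ {i} → i < w → length (F i) ≡ V

δ-orthogonal : ∀ p {x y} → x ≢ y → δ p x * δ p y ≡ 0
δ-orthogonal p {x} {y} x≢y with p ≟ x
... | yes refl = trans (cong (δ p p *_) (δ-≢ x≢y)) (*-zeroʳ (δ p p))
... | no  p≢x  = cong (_* δ p y) (δ-≢ p≢x)

∋-product : ∀ t {x y} → x ≢ y → ∋ t x * ∋ t y ≡ cross x y t
∋-product (p , q , r) {x} {y} x≢y = begin
  (δ p x + δ q x + δ r x) * (δ p y + δ q y + δ r y)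
    ≡⟨ expand (δ p x) (δ q x) (δ r x) (δ p y) (δ q y) (δ r y) ⟩
  δ p x * δ p y + δ q x * δ q y + δ r x * δ r y + cross x y (p , q , r)
    ≡⟨ cong (_+ cross x y (p , q , r)) (cong₂ _+_ (cong₂ _+_ (δ-orthogonal p x≢y) (δ-orthogonal q x≢y)) (δ-orthogonal r x≢y)) ⟩
  cross x y (p , q , r) ∎
  where
  open ≡-Reasoning
  expand : ∀ a b c d e f → (a + b + c) * (d + e + f) ≡
    a * d + b * e + c * f + (a * e + a * f + b * d + b * f + c * d + c * e)
  expand = solve-∀

∋-0⊎1 : ∀ {t} → Distinct t → ∀ x → (∋ t x ≡ 1 × In x t) ⊎ (∋ t x ≡ 0 × ¬ In x t)
∋-0⊎1 {p , q , r} (p≢q , p≢r , q≢r) x with p ≟ x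
... | yes refl rewrite δ-refl p | δ-≢ (p≢q ∘ sym) | δ-≢ (p≢r ∘ sym) = inj₁ (refl , inj₁ refl)
... | no p≢x with q ≟ x
...   | yes refl rewrite δ-refl q | δ-≢ p≢x | δ-≢ (q≢r ∘ sym) = inj₁ (refl , inj₂ (inj₁ refl))
...   | no q≢x with r ≟ x
...     | yes refl rewrite δ-refl r | δ-≢ p≢x | δ-≢ q≢x = inj₁ (refl , inj₂ (inj₂ refl))
...     | no r≢x rewrite δ-≢ p≢x | δ-≢ q≢x | δ-≢ r≢x = inj₂ (refl , λ
  { (inj₁ refl) → p≢x refl ; (inj₂ (inj₁ refl)) → q≢x refl ; (inj₂ (inj₂ refl)) → r≢x refl })

∑-∋ : ∀ {v t} → Inside v t → (f : ℕ → ℕ) →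
  ∑ (upTo v) (λ x → ∋ t x * f x) ≡ f (proj₁ t) + f (proj₁ (proj₂ t)) + f (proj₂ (proj₂ t))
∑-∋ {v} {p , q , r} (p<v , q<v , r<v) f = begin
  ∑ (upTo v) (λ x → (δ p x + δ q x + δ r x) * f x)
    ≡⟨ ∑-ext (upTo v) (λ x → distrib (δ p x) (δ q x) (δ r x) (f x)) ⟩
  ∑ (upTo v) (λ x → δ p x * f x + δ q x * f x + δ r x * f x)
    ≡⟨ trans (∑-+ (upTo v) _ _) (cong (_+ ∑ (upTo v) (λ x → δ r x * f x)) (∑-+ (upTo v) _ _)) ⟩
  ∑ (upTo v) (λ x → δ p x * f x) + ∑ (upTo v) (λ x → δ q x * f x) + ∑ (upTo v) (λ x → δ r x * f x)
    ≡⟨ cong₂ _+_ (cong₂ _+_ (∑-δ p<v f) (∑-δ q<v f)) (∑-δ r<v f) ⟩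
  f p + f q + f r ∎
  where
  open ≡-Reasoning
  distrib : ∀ a b c d → (a + b + c) * d ≡ a * d + b * d + c * d
  distrib = solve-∀

In-⊑ : ∀ {x} t {u} → In x t → t ⊑ u → In x u
In-⊑ t (inj₁ refl)        (p∈ , _ , _) = p∈
In-⊑ t (inj₂ (inj₁ refl)) (_ , q∈ , _) = q∈
In-⊑ t (inj₂ (inj₂ refl)) (_ , _ , r∈) = r∈

total : Triple → ℕ
total (p , q , r) = p + q + r

-- The inclusion gives `∋ t ≤ ∋ u` pointwise. Both sum to 3, so the indicators agree, and so do
-- their sums weighted by `x`. The total modulo `g` will tell the Latin squares apart.
⊑⇒total≡ : ∀ {v t u} → Inside v t → Inside v u → Distinct t → Distinct u → t ⊑ u → total t ≡ total u
⊑⇒total≡ {v} {t} {u} t<v u<v dt du t⊑u = begin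
  total t                          ≡⟨ ∑-∋ t<v id ⟨
  ∑ (upTo v) (λ x → ∋ t x * x)     ≡⟨ ∑-cong (upTo v) (λ {x} x∈ → cong (_* x) (∑-≤-antisym (upTo v) below (≤-reflexive (trans (three u<v) (sym (three t<v)))) x∈)) ⟩
  ∑ (upTo v) (λ x → ∋ u x * x)     ≡⟨ ∑-∋ u<v id ⟩
  total u                          ∎
  where
  open ≡-Reasoning
  three : ∀ {t} → Inside v t → ∑ (upTo v) (∋ t) ≡ 3
  three {t} t<v = trans (∑-ext (upTo v) (λ x → sym (*-identityʳ (∋ t x)))) (∑-∋ t<v (λ _ → 1))
  below : ∀ x → ∋ t x ≤ ∋ u x
  below x with ∋-0⊎1 dt x | ∋-0⊎1 du x
  ... | inj₂ (t≡0 , _)   | _                = subst (_≤ ∋ u x) (sym t≡0) z≤n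
  ... | inj₁ (t≡1 , _)   | inj₁ (u≡1 , _)   = ≤-reflexive (trans t≡1 (sym u≡1))
  ... | inj₁ (_   , x∈t) | inj₂ (_   , x∉u) = contradiction (In-⊑ t x∈t t⊑u) x∉u

block : ∀ v → Triple → Subset v
block v t = tabulate (λ x → 0 <ᵇ ∋ t (toℕ x))

ind-block : ∀ {v t} → Distinct t → ∀ x → ind (block v t) x ≡ ∋ t (toℕ x)
ind-block {v} {t} dt x with ∋-0⊎1 dt (toℕ x)
... | inj₁ (eq , _) = trans (cong (if_then 1 else 0) (trans (lookup∘tabulate _ x) (cong (0 <ᵇ_) eq))) (sym eq)
... | inj₂ (eq , _) = trans (cong (if_then 1 else 0) (trans (lookup∘tabulate _ x) (cong (0 <ᵇ_) eq))) (sym eq)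

∣block∣≡3 : ∀ {v t} → Inside v t → Distinct t → ∣ block v t ∣ ≡ 3
∣block∣≡3 {v} {t} t<v dt = begin
  ∣ block v t ∣                         ≡⟨ ∑-ind (block v t) ⟨
  ∑ (allFin v) (ind (block v t))        ≡⟨ ∑-ext (allFin v) (λ x → trans (ind-block dt x) (sym (*-identityʳ _))) ⟩
  ∑ (allFin v) (λ x → ∋ t (toℕ x) * 1)  ≡⟨ ∑-upTo-toℕ v (λ x → ∋ t x * 1) ⟨
  ∑ (upTo v) (λ x → ∋ t x * 1)          ≡⟨ ∑-∋ t<v (λ _ → 1) ⟩
  3                                     ∎
  where open ≡-Reasoning

block≡⇒⊑ : ∀ {v t u} → Inside v t → Distinct t → Distinct u → block v t ≡ block v u → t ⊑ u
block≡⇒⊑ {v} {t@(p , q , r)} {u} (p<v , q<v , r<v) dt du eq =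
  move p<v (inj₁ refl) , move q<v (inj₂ (inj₁ refl)) , move r<v (inj₂ (inj₂ refl))
  where
  same : ∀ {x} → x < v → ∋ t x ≡ ∋ u x
  same x<v = subst (λ x → ∋ t x ≡ ∋ u x) (toℕ-fromℕ< x<v)
    (trans (sym (ind-block dt (fromℕ< x<v))) (trans (cong (λ B → ind B (fromℕ< x<v)) eq) (ind-block du (fromℕ< x<v))))
  move : ∀ {x} → x < v → In x t → In x u
  move {x} x<v x∈t with ∋-0⊎1 dt x | ∋-0⊎1 du x
  ... | _                | inj₁ (_ , x∈u)   = x∈u
  ... | inj₂ (_ , x∉t)   | inj₂ _           = contradiction x∈t x∉t
  ... | inj₁ (t≡1 , _)   | inj₂ (u≡0 , _)   = contradiction (trans (sym t≡1) (trans (same x<v) u≡0)) λ ()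

-- Any selection of at least two collections of a family is again a trade; taking the first `μ`
-- makes one family serve every `μ ≤ w`.
Family⇒MuWayTrade : ∀ {w v V F} → Family w v V F → 0 < V → ∀ {μ} → μ ≤ w →
  IsMuWayTrade μ v 3 2 (λ i → map (block v) (F (toℕ i)))
Family⇒MuWayTrade {w} {v} {V} {F} fam 0<V {μ} μ≤w i j i≢j =
  collection i , collection j , nonempty i , nonempty j , separate , balance
  where
  open Family fam
  open ≡-Reasoning
  way : (i : Fin μ) → toℕ i < w
  way i = ≤-trans (toℕ<n i) μ≤w
  collection : ∀ i → IsKCollection v 3 (map (block v) (F (toℕ i)))
  collection i = All.tabulate λ B∈ → sized (∈-map⁻ (block v) B∈)
    where
    sized : ∀ {B} → ∃ (λ t → t ∈ F (toℕ i) × B ≡ block v t) → ∣ B ∣ ≡ 3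
    sized (t , t∈ , refl) = ∣block∣≡3 (All.lookup (inside (way i)) t∈) (All.lookup (distinct (way i)) t∈)
  nonempty : ∀ i → map (block v) (F (toℕ i)) ≢ []
  nonempty i eq = <⇒≢ 0<V (trans (cong length (sym eq)) (trans (length-map (block v) (F (toℕ i))) (volume (way i))))
  separate : Disjoint (map (block v) (F (toℕ i))) (map (block v) (F (toℕ j)))
  separate B B∈i B∈j with ∈-map⁻ (block v) B∈i | ∈-map⁻ (block v) B∈j
  ... | t , t∈ , refl | u , u∈ , eq = disjoint (way i) (way j) (i≢j ∘ toℕ-injective) t∈ u∈
    (block≡⇒⊑ (All.lookup (inside (way i)) t∈) (All.lookup (distinct (way i)) t∈) (All.lookup (distinct (way j)) u∈) eq)
  pairCount-block : ∀ i {x y} → x ≢ y → pairCount (map (block v) (F (toℕ i))) x y ≡ ∑ (F (toℕ i)) (cross (toℕ x) (toℕ y))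
  pairCount-block i {x} {y} x≢y = trans (∑-map (block v) (F (toℕ i)) (λ B → ind B x * ind B y))
    (∑-cong (F (toℕ i)) λ {t} t∈ → let dt = All.lookup (distinct (way i)) t∈ in
      trans (cong₂ _*_ (ind-block dt x) (ind-block dt y)) (∋-product t (x≢y ∘ toℕ-injective)))
  balance : (s : Subset v) → ∣ s ∣ ≡ 2 →
    count s (map (block v) (F (toℕ i))) ≡ count s (map (block v) (F (toℕ j)))
  balance s ∣s∣≡2 with ∣s∣≡2⇒pair s ∣s∣≡2
  ... | x , y , x≢y , refl = begin
    count (⁅ x ⁆ ∪ ⁅ y ⁆) (map (block v) (F (toℕ i)))  ≡⟨ count-pair x y (map (block v) (F (toℕ i))) ⟩
    pairCount (map (block v) (F (toℕ i))) x y          ≡⟨ pairCount-block i x≢y ⟩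
    ∑ (F (toℕ i)) (cross (toℕ x) (toℕ y))              ≡⟨ balanced (way i) (way j) (toℕ<n x) (toℕ<n y) ⟩
    ∑ (F (toℕ j)) (cross (toℕ x) (toℕ y))              ≡⟨ pairCount-block j x≢y ⟨
    pairCount (map (block v) (F (toℕ j))) x y          ≡⟨ count-pair x y (map (block v) (F (toℕ j))) ⟨
    count (⁅ x ⁆ ∪ ⁅ y ⁆) (map (block v) (F (toℕ j)))  ∎

-- Inflation by Latin squares

module Inflation (g : ℕ) .{{_ : NonZero g}} where

  open ≡-Reasoning

  residues : List ℕ
  residues = upTo g

  -- Moving the window of `g` consecutive arguments one step drops `h k` and gains `h (k + g)`,
  -- which are equal. The proof splits the sum over `g + 1` arguments once at its first and once at
  -- its last term.
  ∑-shift : ∀ (h : ℕ → ℕ) → (∀ k → h (k + g) ≡ h k) → ∀ k → ∑ residues (λ c → h (k + c)) ≡ ∑ residues h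
  ∑-shift h periodic zero    = refl
  ∑-shift h periodic (suc k) = trans (+-cancelˡ-≡ (h k) _ _ (begin
    h k + ∑ residues (λ c → h (suc k + c))           ≡⟨ cong₂ _+_ (cong h (+-identityʳ k)) (∑-ext residues (λ c → cong h (+-suc k c))) ⟨
    h (k + 0) + ∑ residues (λ c → h (k + suc c))     ≡⟨ ∑-upTo-suc g (λ c → h (k + c)) ⟨
    ∑ (upTo (suc g)) (λ c → h (k + c))               ≡⟨ ∑-upTo-last g (λ c → h (k + c)) ⟩
    ∑ residues (λ c → h (k + c)) + h (k + g)         ≡⟨ cong (∑ residues (λ c → h (k + c)) +_) (periodic k) ⟩
    ∑ residues (λ c → h (k + c)) + h k               ≡⟨ +-comm _ (h k) ⟩
    h k + ∑ residues (λ c → h (k + c))               ∎)) (∑-shift h periodic k)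

  -- The congruence for `c` may be shifted to `k = 0`, where `c = s` is the only residue that solves
  -- it. This is the Latin property in its basic form.
  one-solution : ∀ k {s} → s < g → ∑ residues (λ c → δ ((k + c) % g) s) ≡ 1
  one-solution k {s} s<g = begin
    ∑ residues (λ c → δ ((k + c) % g) s)    ≡⟨ ∑-shift (λ c → δ (c % g) s) (λ k → cong (λ c → δ c s) ([m+n]%n≡m%n k g)) k ⟩
    ∑ residues (λ c → δ (c % g) s)          ≡⟨ ∑-cong residues (λ {c} c∈ → trans (cong (λ c → δ c s) (m<n⇒m%n≡m (∈-upTo⁻ c∈))) (trans (δ-sym c s) (sym (*-identityʳ (δ s c))))) ⟩
    ∑ residues (λ c → δ s c * 1)            ≡⟨ ∑-δ s<g (λ _ → 1) ⟩
    1                                       ∎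

  -- The cells (row, column, symbol) of a Latin square; different s give disjoint squares.
  latin : ℕ → List Triple
  latin s = filter (λ t → total t % g ≟ s) (cartesianProduct residues (cartesianProduct residues residues))

  latin-inside : ∀ {s t} → t ∈ latin s → Inside g t
  latin-inside {s} t∈ with ∈-filter⁻ (λ t → total t % g ≟ s) {xs = cartesianProduct residues (cartesianProduct residues residues)} t∈
  ... | t∈³ , _ with ∈-cartesianProduct⁻ residues (cartesianProduct residues residues) t∈³
  ...   | a∈ , bc∈ with ∈-cartesianProduct⁻ residues residues bc∈
  ...     | b∈ , c∈ = ∈-upTo⁻ a∈ , ∈-upTo⁻ b∈ , ∈-upTo⁻ c∈

  latin-total : ∀ {s t} → t ∈ latin s → total t % g ≡ s
  latin-total {s} t∈ = proj₂ (∈-filter⁻ (λ t → total t % g ≟ s) {xs = cartesianProduct residues (cartesianProduct residues residues)} t∈)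

  ∑-latin : ∀ s f → ∑ (latin s) f ≡
    ∑ residues (λ a → ∑ residues (λ b → ∑ residues (λ c → δ ((a + b + c) % g) s * f (a , b , c))))
  ∑-latin s f = begin
    ∑ (latin s) f
      ≡⟨ ∑-δ-filter (cartesianProduct residues (cartesianProduct residues residues)) (λ t → total t % g) s f ⟩
    ∑ (cartesianProduct residues (cartesianProduct residues residues)) (λ t → δ (total t % g) s * f t)
      ≡⟨ ∑-cartesianProduct residues (cartesianProduct residues residues) _ ⟩
    ∑ residues (λ a → ∑ (cartesianProduct residues residues) (λ bc → δ (total (a , bc) % g) s * f (a , bc)))
      ≡⟨ ∑-ext residues (λ a → ∑-cartesianProduct residues residues _) ⟩
    _ ∎

  module _ {s : ℕ} (s<g : s < g) where

    latin-length : length (latin s) ≡ g * g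
    latin-length = begin
      length (latin s)                                    ≡⟨ length≡∑ (latin s) ⟩
      ∑ (latin s) (λ _ → 1)                               ≡⟨ ∑-latin s (λ _ → 1) ⟩
      ∑ residues (λ a → ∑ residues (λ b → ∑ residues (λ c → δ ((a + b + c) % g) s * 1)))
        ≡⟨ ∑-ext residues (λ a → ∑-ext residues (λ b → trans (∑-ext residues (λ c → *-identityʳ _)) (one-solution (a + b) s<g))) ⟩
      ∑ residues (λ a → ∑ residues (λ b → 1))             ≡⟨ ∑-ext residues (λ a → trans (sym (length≡∑ residues)) (length-upTo g)) ⟩
      ∑ residues (λ a → g)                                ≡⟨ ∑-const residues g ⟩
      length residues * g                                 ≡⟨ cong (_* g) (length-upTo g) ⟩
      g * g                                               ∎

    module _ {α β : ℕ} (α<g : α < g) (β<g : β < g) where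

      -- Here and in `latin-13` and `latin-23`, two coordinates of a cell are prescribed. The third
      -- is the unknown of a congruence counted by `one-solution`.
      latin-12 : ∑ (latin s) (λ (a , b , c) → δ a α * δ b β) ≡ 1
      latin-12 = begin
        _ ≡⟨ ∑-latin s _ ⟩
        ∑ residues (λ a → ∑ residues (λ b → ∑ residues (λ c → δ ((a + b + c) % g) s * (δ a α * δ b β))))
          ≡⟨ ∑-ext residues (λ a → ∑-ext residues (λ b → ∑-*ʳ (δ a α * δ b β) residues _)) ⟩
        ∑ residues (λ a → ∑ residues (λ b → ∑ residues (λ c → δ ((a + b + c) % g) s) * (δ a α * δ b β)))
          ≡⟨ ∑-ext residues (λ a → ∑-ext residues (λ b → trans (cong (_* (δ a α * δ b β)) (one-solution (a + b) s<g)) (*-identityˡ _))) ⟩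
        ∑ residues (λ a → ∑ residues (λ b → δ a α * δ b β))
          ≡⟨ two-deltas ⟩
        1 ∎
        where
        two-deltas : ∑ residues (λ a → ∑ residues (λ b → δ a α * δ b β)) ≡ 1
        two-deltas = begin
          ∑ residues (λ a → ∑ residues (λ b → δ a α * δ b β)) ≡⟨ ∑-ext residues (λ a → trans (∑-*ˡ (δ a α) residues (λ b → δ b β)) (cong₂ _*_ (δ-sym a α) (one β<g))) ⟩
          ∑ residues (λ a → δ α a * 1)                        ≡⟨ ∑-δ α<g (λ _ → 1) ⟩
          1 ∎
          where
          one : ∀ {β} → β < g → ∑ residues (λ b → δ b β) ≡ 1
          one {β} β<g = trans (∑-ext residues (λ b → trans (δ-sym b β) (sym (*-identityʳ _)))) (∑-δ β<g (λ _ → 1))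

      latin-13 : ∑ (latin s) (λ (a , b , c) → δ a α * δ c β) ≡ 1
      latin-13 = begin
        _ ≡⟨ ∑-latin s _ ⟩
        ∑ residues (λ a → ∑ residues (λ b → ∑ residues (λ c → δ ((a + b + c) % g) s * (δ a α * δ c β))))
          ≡⟨ ∑-ext residues (λ a → ∑-ext residues (λ b → ∑-ext residues (λ c → trans (cong₂ (λ x y → δ ((a + b + c) % g) s * (x * y)) (δ-sym a α) (δ-sym c β)) (rearrange (δ ((a + b + c) % g) s) (δ α a) (δ β c))))) ⟩
        ∑ residues (λ a → ∑ residues (λ b → ∑ residues (λ c → δ β c * (δ α a * δ ((a + b + c) % g) s))))
          ≡⟨ ∑-ext residues (λ a → ∑-ext residues (λ b → ∑-δ β<g (λ c → δ α a * δ ((a + b + c) % g) s))) ⟩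
        ∑ residues (λ a → ∑ residues (λ b → δ α a * δ ((a + b + β) % g) s))
          ≡⟨ ∑-ext residues (λ a → ∑-*ˡ (δ α a) residues (λ b → δ ((a + b + β) % g) s)) ⟩
        ∑ residues (λ a → δ α a * ∑ residues (λ b → δ ((a + b + β) % g) s))
          ≡⟨ ∑-δ α<g (λ a → ∑ residues (λ b → δ ((a + b + β) % g) s)) ⟩
        ∑ residues (λ b → δ ((α + b + β) % g) s)
          ≡⟨ ∑-ext residues (λ b → cong (λ n → δ (n % g) s) (swap α b β)) ⟩
        ∑ residues (λ b → δ ((α + β + b) % g) s)
          ≡⟨ one-solution (α + β) s<g ⟩
        1 ∎
        where
        rearrange : ∀ x y z → x * (y * z) ≡ z * (y * x)
        rearrange = solve-∀
        swap : ∀ x y z → x + y + z ≡ x + z + y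
        swap = solve-∀

      latin-23 : ∑ (latin s) (λ (a , b , c) → δ b α * δ c β) ≡ 1
      latin-23 = begin
        _ ≡⟨ ∑-latin s _ ⟩
        ∑ residues (λ a → ∑ residues (λ b → ∑ residues (λ c → δ ((a + b + c) % g) s * (δ b α * δ c β))))
          ≡⟨ ∑-ext residues (λ a → ∑-ext residues (λ b → ∑-ext residues (λ c → trans (cong₂ (λ x y → δ ((a + b + c) % g) s * (x * y)) (δ-sym b α) (δ-sym c β)) (rearrange (δ ((a + b + c) % g) s) (δ α b) (δ β c))))) ⟩
        ∑ residues (λ a → ∑ residues (λ b → ∑ residues (λ c → δ β c * (δ α b * δ ((a + b + c) % g) s))))
          ≡⟨ ∑-ext residues (λ a → ∑-ext residues (λ b → ∑-δ β<g (λ c → δ α b * δ ((a + b + c) % g) s))) ⟩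
        ∑ residues (λ a → ∑ residues (λ b → δ α b * δ ((a + b + β) % g) s))
          ≡⟨ ∑-ext residues (λ a → ∑-δ α<g (λ b → δ ((a + b + β) % g) s)) ⟩
        ∑ residues (λ a → δ ((a + α + β) % g) s)
          ≡⟨ ∑-ext residues (λ a → cong (λ n → δ (n % g) s) (rotate a α β)) ⟩
        ∑ residues (λ a → δ ((α + β + a) % g) s)
          ≡⟨ one-solution (α + β) s<g ⟩
        1 ∎
        where
        rearrange : ∀ x y z → x * (y * z) ≡ z * (y * x)
        rearrange = solve-∀
        rotate : ∀ x y z → x + y + z ≡ y + z + x
        rotate = solve-∀

  -- The point `(p , a)` of the inflated set is coded as `a + p * g`, so that `/ g` and `% g`
  -- recover its two parts.
  lift : Triple → Triple → Triple
  lift (p , q , r) (a , b , c) = a + p * g , b + q * g , c + r * g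

  lift-% : ∀ {a} → a < g → ∀ p → (a + p * g) % g ≡ a
  lift-% {a} a<g p = trans ([m+kn]%n≡m%n a p g) (m<n⇒m%n≡m a<g)

  lift-/ : ∀ {a} → a < g → ∀ p → (a + p * g) / g ≡ p
  lift-/ {a} a<g p = trans (+-distrib-/-∣ʳ a (n∣m*n p)) (cong₂ _+_ (m<n⇒m/n≡0 a<g) (m*n/n≡m p g))

  lift-< : ∀ {a p v} → a < g → p < v → a + p * g < v * g
  lift-< {a} {p} {v} a<g p<v = ≤-trans (+-monoˡ-≤ (p * g) a<g) (*-monoˡ-≤ g p<v)

  lift-injectiveʳ : ∀ {a b p q} → a < g → b < g → a + p * g ≡ b + q * g → p ≡ q
  lift-injectiveʳ {a} {b} {p} {q} a<g b<g eq = trans (sym (lift-/ a<g p)) (trans (cong (_/ g) eq) (lift-/ b<g q))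

  lift-⊑ : ∀ t u {s s′} → Inside g s → Inside g s′ → lift t s ⊑ lift u s′ → t ⊑ u
  lift-⊑ (p , q , r) (p′ , q′ , r′) (a< , b< , c<) (a′< , b′< , c′<) (P∈ , Q∈ , R∈) = lower a< P∈ , lower b< Q∈ , lower c< R∈
    where
    lower : ∀ {a p} → a < g → In (a + p * g) (lift (p′ , q′ , r′) _) → In p (p′ , q′ , r′)
    lower a< (inj₁ eq)        = inj₁ (lift-injectiveʳ a< a′< eq)
    lower a< (inj₂ (inj₁ eq)) = inj₂ (inj₁ (lift-injectiveʳ a< b′< eq))
    lower a< (inj₂ (inj₂ eq)) = inj₂ (inj₂ (lift-injectiveʳ a< c′< eq))

  total-lift : ∀ t s → total (lift t s) % g ≡ total s % g
  total-lift (p , q , r) (a , b , c) = trans (cong (_% g) (regroup a b c p q r g)) ([m+kn]%n≡m%n (a + b + c) (p + q + r) g)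
    where
    regroup : ∀ a b c p q r g → a + p * g + (b + q * g) + (c + r * g) ≡ a + b + c + (p + q + r) * g
    regroup = solve-∀

  δ-lift : ∀ {a} → a < g → ∀ p x → δ (a + p * g) x ≡ δ p (x / g) * δ a (x % g)
  δ-lift {a} a<g p x with a + p * g ≟ x
  ... | yes refl rewrite lift-% a<g p | lift-/ a<g p | δ-refl (a + p * g) | δ-refl p | δ-refl a = refl
  ... | no  ≢x with p ≟ x / g | a ≟ x % g
  ...   | no  p≢ | _     = trans (δ-≢ ≢x) (sym (cong (_* δ a (x % g)) (δ-≢ p≢)))
  ...   | yes p≡ | no a≢ = trans (δ-≢ ≢x) (sym (trans (cong (δ p (x / g) *_) (δ-≢ a≢)) (*-zeroʳ (δ p (x / g)))))
  ...   | yes p≡ | yes a≡ = contradiction (trans (cong₂ (λ a p → a + p * g) a≡ p≡) (sym (m≡m%n+[m/n]*n x g))) ≢x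

  -- Each of the six terms splits into a base factor and a Latin factor. The Latin factors are
  -- written with the coordinates in increasing order, the form expected by `latin-12`, `latin-13`
  -- and `latin-23`.
  cross-lift : ∀ (t : Triple) {s} → Inside g s → (x y : ℕ) → let (p , q , r) = t; (a , b , c) = s in
    cross x y (lift t s) ≡
      δ p (x / g) * δ q (y / g) * (δ a (x % g) * δ b (y % g)) +
      δ p (x / g) * δ r (y / g) * (δ a (x % g) * δ c (y % g)) +
      δ q (x / g) * δ p (y / g) * (δ a (y % g) * δ b (x % g)) +
      δ q (x / g) * δ r (y / g) * (δ b (x % g) * δ c (y % g)) +
      δ r (x / g) * δ p (y / g) * (δ a (y % g) * δ c (x % g)) +
      δ r (x / g) * δ q (y / g) * (δ b (y % g) * δ c (x % g))
  cross-lift (p , q , r) (a< , b< , c<) x y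
    rewrite δ-lift a< p x | δ-lift a< p y | δ-lift b< q x | δ-lift b< q y | δ-lift c< r x | δ-lift c< r y =
    regroup (δ p (x / g)) (δ q (x / g)) (δ r (x / g)) (δ p (y / g)) (δ q (y / g)) (δ r (y / g)) _ _ _ _ _ _
    where
    regroup : ∀ p q r p′ q′ r′ a b c a′ b′ c′ →
      p * a * (q′ * b′) + p * a * (r′ * c′) + q * b * (p′ * a′) + q * b * (r′ * c′) + r * c * (p′ * a′) + r * c * (q′ * b′) ≡
      p * q′ * (a * b′) + p * r′ * (a * c′) + q * p′ * (a′ * b) + q * r′ * (b * c′) + r * p′ * (a′ * c) + r * q′ * (b′ * c)
    regroup = solve-∀

  -- Summed over the square, each Latin factor becomes 1 and only the base factors remain. Pair
  -- counts after inflation are therefore those of the base points, whichever square is used.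
  ∑-cross-lift : ∀ {s} → s < g → ∀ t x y → ∑ (latin s) (λ l → cross x y (lift t l)) ≡ cross (x / g) (y / g) t
  ∑-cross-lift {s} s<g t@(p , q , r) x y = begin
    ∑ (latin s) (λ l → cross x y (lift t l))
      ≡⟨ ∑-cong (latin s) (λ l∈ → cross-lift t (latin-inside l∈) x y) ⟩
    ∑ (latin s) (λ l → f₁ l + f₂ l + f₃ l + f₄ l + f₅ l + f₆ l)
      ≡⟨ trans (∑-+ (latin s) _ f₆) (cong (_+ ∑ (latin s) f₆) (trans (∑-+ (latin s) _ f₅) (cong (_+ ∑ (latin s) f₅) (trans (∑-+ (latin s) _ f₄) (cong (_+ ∑ (latin s) f₄) (trans (∑-+ (latin s) _ f₃) (cong (_+ ∑ (latin s) f₃) (∑-+ (latin s) f₁ f₂)))))))) ⟩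
    ∑ (latin s) f₁ + ∑ (latin s) f₂ + ∑ (latin s) f₃ + ∑ (latin s) f₄ + ∑ (latin s) f₅ + ∑ (latin s) f₆
      ≡⟨ cong₂ _+_ (cong₂ _+_ (cong₂ _+_ (cong₂ _+_ (cong₂ _+_
           (scaled (δ p (x / g) * δ q (y / g)) (latin-12 s<g x< y<)) (scaled (δ p (x / g) * δ r (y / g)) (latin-13 s<g x< y<)))
           (scaled (δ q (x / g) * δ p (y / g)) (latin-12 s<g y< x<))) (scaled (δ q (x / g) * δ r (y / g)) (latin-23 s<g x< y<)))
           (scaled (δ r (x / g) * δ p (y / g)) (latin-13 s<g y< x<))) (scaled (δ r (x / g) * δ q (y / g)) (latin-23 s<g y< x<)) ⟩
    cross (x / g) (y / g) t ∎
    where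
    x< = m%n<n x g
    y< = m%n<n y g
    f₁ f₂ f₃ f₄ f₅ f₆ : Triple → ℕ
    f₁ (a , b , c) = δ p (x / g) * δ q (y / g) * (δ a (x % g) * δ b (y % g))
    f₂ (a , b , c) = δ p (x / g) * δ r (y / g) * (δ a (x % g) * δ c (y % g))
    f₃ (a , b , c) = δ q (x / g) * δ p (y / g) * (δ a (y % g) * δ b (x % g))
    f₄ (a , b , c) = δ q (x / g) * δ r (y / g) * (δ b (x % g) * δ c (y % g))
    f₅ (a , b , c) = δ r (x / g) * δ p (y / g) * (δ a (y % g) * δ c (x % g))
    f₆ (a , b , c) = δ r (x / g) * δ q (y / g) * (δ b (y % g) * δ c (x % g))
    scaled : ∀ c {f} → ∑ (latin s) f ≡ 1 → ∑ (latin s) (λ l → c * f l) ≡ c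
    scaled c {f} eq = trans (∑-*ˡ c (latin s) f) (trans (cong (c *_) eq) (*-identityʳ c))

  -- The index `i` codes a base collection `i / g` together with a Latin square `i % g`.
  inflate : (ℕ → List Triple) → ℕ → List Triple
  inflate F i = concatMap (λ t → map (lift t) (latin (i % g))) (F (i / g))

  inflate-∈ : ∀ F i {T} → T ∈ inflate F i → ∃₂ λ t s → t ∈ F (i / g) × s ∈ latin (i % g) × T ≡ lift t s
  inflate-∈ F i T∈ with find (∈-concatMap⁻ (λ t → map (lift t) (latin (i % g))) {xs = F (i / g)} T∈)
  ... | t , t∈ , T∈′ with ∈-map⁻ (lift t) T∈′
  ...   | s , s∈ , eq = t , s , t∈ , s∈ , eq

  inflate-Family : ∀ {w v V F} → Family w v V F → Family (w * g) (v * g) (V * (g * g)) (inflate F)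
  inflate-Family {w} {v} {V} {F} fam = record
    { inside  = λ i<wg → All.tabulate (inside-lift i<wg)
    ; distinct = λ i<wg → All.tabulate (distinct-lift i<wg)
    ; balanced = λ {i} {j} i<wg j<wg {x} {y} x<vg y<vg → begin
        ∑ (inflate F i) (cross x y)              ≡⟨ ∑-cross-inflate i x y ⟩
        ∑ (F (i / g)) (cross (x / g) (y / g))    ≡⟨ balanced (m<n*o⇒m/o<n i<wg) (m<n*o⇒m/o<n j<wg) (m<n*o⇒m/o<n x<vg) (m<n*o⇒m/o<n y<vg) ⟩
        ∑ (F (j / g)) (cross (x / g) (y / g))    ≡⟨ ∑-cross-inflate j x y ⟨
        ∑ (inflate F j) (cross x y)              ∎
    ; disjoint = disjoint-lift
    ; volume   = λ {i} i<wg → begin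
        length (inflate F i)                                        ≡⟨ length≡∑ (inflate F i) ⟩
        ∑ (inflate F i) (λ _ → 1)                                   ≡⟨ ∑-concatMap (λ t → map (lift t) (latin (i % g))) (F (i / g)) _ ⟩
        ∑ (F (i / g)) (λ t → ∑ (map (lift t) (latin (i % g))) (λ _ → 1))
          ≡⟨ ∑-ext (F (i / g)) (λ t → trans (sym (length≡∑ (map (lift t) (latin (i % g))))) (trans (length-map (lift t) (latin (i % g))) (latin-length (m%n<n i g)))) ⟩
        ∑ (F (i / g)) (λ _ → g * g)                                 ≡⟨ ∑-const (F (i / g)) (g * g) ⟩
        length (F (i / g)) * (g * g)                                ≡⟨ cong (_* (g * g)) (volume (m<n*o⇒m/o<n i<wg)) ⟩
        V * (g * g)                                                 ∎
    }
    where
    open Family fam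

    ∑-cross-inflate : ∀ i x y → ∑ (inflate F i) (cross x y) ≡ ∑ (F (i / g)) (cross (x / g) (y / g))
    ∑-cross-inflate i x y = trans (∑-concatMap (λ t → map (lift t) (latin (i % g))) (F (i / g)) (cross x y))
      (∑-ext (F (i / g)) (λ t → trans (∑-map (lift t) (latin (i % g)) (cross x y)) (∑-cross-lift (m%n<n i g) t x y)))

    inside-lift : ∀ {i} → i < w * g → ∀ {T} → T ∈ inflate F i → Inside (v * g) T
    inside-lift {i} i<wg T∈ with inflate-∈ F i T∈
    ... | t , s , t∈ , s∈ , refl with All.lookup (inside (m<n*o⇒m/o<n i<wg)) t∈ | latin-inside s∈
    ...   | p< , q< , r< | a< , b< , c< = lift-< a< p< , lift-< b< q< , lift-< c< r<

    distinct-lift : ∀ {i} → i < w * g → ∀ {T} → T ∈ inflate F i → Distinct T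
    distinct-lift {i} i<wg T∈ with inflate-∈ F i T∈
    ... | t , s , t∈ , s∈ , refl with All.lookup (distinct (m<n*o⇒m/o<n i<wg)) t∈ | latin-inside s∈
    ...   | p≢q , p≢r , q≢r | a< , b< , c< =
      p≢q ∘ lift-injectiveʳ a< b< , p≢r ∘ lift-injectiveʳ a< c< , q≢r ∘ lift-injectiveʳ b< c<

    -- If the base indices differ, projecting the inclusion to the base contradicts disjointness
    -- there. If they agree, equal sets have equal totals, and modulo `g` these are `i % g` and
    -- `j % g`; then `i = j`.
    disjoint-lift : ∀ {i j} → i < w * g → j < w * g → i ≢ j →
      ∀ {T U} → T ∈ inflate F i → U ∈ inflate F j → ¬ T ⊑ U
    disjoint-lift {i} {j} i< j< i≢j {T} {U} T∈ U∈ T⊑U with inflate-∈ F i T∈ | inflate-∈ F j U∈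
    ... | t , s , t∈ , s∈ , refl | u , s′ , u∈ , s′∈ , refl with i / g ≟ j / g
    ...   | no  ≢/ = disjoint (m<n*o⇒m/o<n i<) (m<n*o⇒m/o<n j<) ≢/ t∈ u∈ (lift-⊑ t u (latin-inside s∈) (latin-inside s′∈) T⊑U)
    ...   | yes ≡/ = i≢j (begin
      i                        ≡⟨ m≡m%n+[m/n]*n i g ⟩
      i % g + i / g * g        ≡⟨ cong₂ (λ r d → r + d * g) ≡% ≡/ ⟩
      j % g + j / g * g        ≡⟨ m≡m%n+[m/n]*n j g ⟨
      j                        ∎)
      where
      ≡% : i % g ≡ j % g
      ≡% = begin
        i % g                     ≡⟨ latin-total s∈ ⟨
        total s % g               ≡⟨ total-lift t s ⟨
        total (lift t s) % g      ≡⟨ cong (_% g) (⊑⇒total≡ (inside-lift i< T∈) (inside-lift j< U∈) (distinct-lift i< T∈) (distinct-lift j< U∈) T⊑U) ⟩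
        total (lift u s′) % g     ≡⟨ total-lift u s′ ⟩
        total s′ % g              ≡⟨ latin-total s′∈ ⟩
        j % g                     ∎

-- Cyclic development

In? : ∀ x t → Dec (In x t)
In? x (p , q , r) = x ≟ p ⊎-dec x ≟ q ⊎-dec x ≟ r

_⊑?_ : ∀ t u → Dec (t ⊑ u)
(p , q , r) ⊑? u = In? p u ×-dec In? q u ×-dec In? r u

Apart : List Triple → List Triple → Set
Apart K L = All (λ t → All (λ u → ¬ t ⊑ u) L) K

apart? : ∀ K L → Dec (Apart K L)
apart? K L = All.all? (λ t → All.all? (λ u → ¬? (t ⊑? u)) L) K

module Cyclic (w : ℕ) .{{_ : NonZero w}} where

  open ≡-Reasoning

  -- The points below w form ℤ/w, the others are fixed.
  rot back : ℕ → ℕ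
  rot  x = if x <ᵇ w then suc x % w else x
  back x = if x <ᵇ w then (x + (w ∸ 1)) % w else x

  rot₃ : Triple → Triple
  rot₃ (p , q , r) = rot p , rot q , rot r

  develop : List Triple → ℕ → List Triple
  develop L zero    = L
  develop L (suc j) = map rot₃ (develop L j)

  Permutes : ℕ → Set
  Permutes v = ∀ {x} → x < v → rot x < v × back x < v × back (rot x) ≡ x × rot (back x) ≡ x

  Invariant : ℕ → List Triple → Set
  Invariant v L = ∀ {x} → x < v → ∀ {y} → y < v → ∑ L (cross (rot x) (rot y)) ≡ ∑ L (cross x y)

  -- The shifts `suc d` run through 1 to `w ∸ 1`. Both directions of inclusion are recorded, since
  -- the unshifted list may supply either side of a comparison.
  Scattered : List Triple → Set
  Scattered L = ∀ {d} → d < w ∸ 1 → Apart L (develop L (suc d)) × Apart (develop L (suc d)) L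

  -- All properties of the `w` rotated copies follow from these bounded, decidable conditions on one
  -- list, so a concrete list is certified by evaluating `starter?`.
  Starter : ℕ → List Triple → Set
  Starter v L = Permutes v × All (Inside v) L × All Distinct L × Invariant v L × Scattered L

  starter? : ∀ v L → Dec (Starter v L)
  starter? v L =
    allUpTo? (λ x → rot x <? v ×-dec back x <? v ×-dec back (rot x) ≟ x ×-dec rot (back x) ≟ x) v
    ×-dec All.all? (λ (p , q , r) → p <? v ×-dec q <? v ×-dec r <? v) L
    ×-dec All.all? (λ (p , q , r) → ¬? (p ≟ q) ×-dec ¬? (p ≟ r) ×-dec ¬? (q ≟ r)) L
    ×-dec allUpTo? (λ x → allUpTo? (λ y → ∑ L (cross (rot x) (rot y)) ≟ ∑ L (cross x y)) v) v
    ×-dec allUpTo? (λ d → clash? (develop L (suc d))) (w ∸ 1)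
    where
    clash? : ∀ K → Dec (Apart L K × Apart K L)
    clash? K = apart? L K ×-dec apart? K L

  module _ {v L} (S : Starter v L) where

    private
      invertible : Permutes v
      invertible = proj₁ S
      inside : All (Inside v) L
      inside = proj₁ (proj₂ S)
      distinct : All Distinct L
      distinct = proj₁ (proj₂ (proj₂ S))
      invariant : Invariant v L
      invariant = proj₁ (proj₂ (proj₂ (proj₂ S)))
      scattered : Scattered L
      scattered = proj₂ (proj₂ (proj₂ (proj₂ S)))

    rot-injective : ∀ {x y} → x < v → y < v → rot x ≡ rot y → x ≡ y
    rot-injective {x} {y} x<v y<v eq = begin
      x              ≡⟨ proj₁ (proj₂ (proj₂ (invertible x<v))) ⟨
      back (rot x)   ≡⟨ cong back eq ⟩
      back (rot y)   ≡⟨ proj₁ (proj₂ (proj₂ (invertible y<v))) ⟩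
      y              ∎

    δ-rot : ∀ {x y} → x < v → y < v → δ (rot x) (rot y) ≡ δ x y
    δ-rot {x} {y} x<v y<v with x ≟ y
    ... | yes refl = trans (δ-refl (rot x)) (sym (δ-refl x))
    ... | no  x≢y  = trans (δ-≢ (x≢y ∘ rot-injective x<v y<v)) (sym (δ-≢ x≢y))

    cross-rot : ∀ {x y t} → x < v → y < v → Inside v t → cross (rot x) (rot y) (rot₃ t) ≡ cross x y t
    cross-rot x< y< (p< , q< , r<) rewrite δ-rot p< x< | δ-rot p< y< | δ-rot q< x< | δ-rot q< y< | δ-rot r< x< | δ-rot r< y< = refl

    In-rot⁻ : ∀ {x t} → x < v → Inside v t → In (rot x) (rot₃ t) → In x t
    In-rot⁻ x< (p< , q< , r<) (inj₁ eq)        = inj₁ (rot-injective x< p< eq)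
    In-rot⁻ x< (p< , q< , r<) (inj₂ (inj₁ eq)) = inj₂ (inj₁ (rot-injective x< q< eq))
    In-rot⁻ x< (p< , q< , r<) (inj₂ (inj₂ eq)) = inj₂ (inj₂ (rot-injective x< r< eq))

    ⊑-rot⁻ : ∀ {t u} → Inside v t → Inside v u → rot₃ t ⊑ rot₃ u → t ⊑ u
    ⊑-rot⁻ (p< , q< , r<) u< (p∈ , q∈ , r∈) = In-rot⁻ p< u< p∈ , In-rot⁻ q< u< q∈ , In-rot⁻ r< u< r∈

    develop-inside : ∀ j {t} → t ∈ develop L j → Inside v t
    develop-inside zero    t∈ = All.lookup inside t∈
    develop-inside (suc j) t∈ with ∈-map⁻ rot₃ t∈
    ... | _ , u∈ , refl with develop-inside j u∈
    ...   | p< , q< , r< = proj₁ (invertible p<) , proj₁ (invertible q<) , proj₁ (invertible r<)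

    develop-distinct : ∀ j {t} → t ∈ develop L j → Distinct t
    develop-distinct zero    t∈ = All.lookup distinct t∈
    develop-distinct (suc j) t∈ with ∈-map⁻ rot₃ t∈
    ... | _ , u∈ , refl with develop-inside j u∈ | develop-distinct j u∈
    ...   | p< , q< , r< | p≢q , p≢r , q≢r =
      p≢q ∘ rot-injective p< q< , p≢r ∘ rot-injective p< r< , q≢r ∘ rot-injective q< r<

    -- The count of a rotated list at `x`, `y` is that of the previous list at `back x`, `back y`.
    -- By induction this is the count of `L` there, and invariance of `L` carries it forward again.
    develop-balanced : ∀ j {x y} → x < v → y < v → ∑ (develop L j) (cross x y) ≡ ∑ L (cross x y)
    develop-balanced zero    x<v y<v = refl
    develop-balanced (suc j) {x} {y} x<v y<v with invertible x<v | invertible y<v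
    ... | _ , x′<v , _ , rotx′≡x | _ , y′<v , _ , roty′≡y = begin
      ∑ (map rot₃ (develop L j)) (cross x y)
        ≡⟨ ∑-map rot₃ (develop L j) (cross x y) ⟩
      ∑ (develop L j) (cross x y ∘ rot₃)
        ≡⟨ ∑-ext (develop L j) (λ t → cong₂ (λ x y → cross x y (rot₃ t)) rotx′≡x roty′≡y) ⟨
      ∑ (develop L j) (cross (rot (back x)) (rot (back y)) ∘ rot₃)
        ≡⟨ ∑-cong (develop L j) (λ t∈ → cross-rot x′<v y′<v (develop-inside j t∈)) ⟩
      ∑ (develop L j) (cross (back x) (back y))
        ≡⟨ develop-balanced j x′<v y′<v ⟩
      ∑ L (cross (back x) (back y))
        ≡⟨ invariant x′<v y′<v ⟨
      ∑ L (cross (rot (back x)) (rot (back y)))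
        ≡⟨ ∑-ext L (λ t → cong₂ (λ x y → cross x y t) rotx′≡x roty′≡y) ⟩
      ∑ L (cross x y) ∎

    -- Undoing `i` rotations on both sides reduces the comparison to `L` against its copy rotated
    -- `suc d` times, which is `Scattered`.
    develop-apart : ∀ i {d} → d < w ∸ 1 → ∀ {t u} → t ∈ develop L i → u ∈ develop L (i + suc d) → ¬ t ⊑ u × ¬ u ⊑ t
    develop-apart zero d< t∈ u∈ with scattered d<
    ... | L-K , K-L = All.lookup (All.lookup L-K t∈) u∈ , All.lookup (All.lookup K-L u∈) t∈
    develop-apart (suc i) {d} d< t∈ u∈ with ∈-map⁻ rot₃ t∈ | ∈-map⁻ rot₃ u∈
    ... | _ , t∈′ , refl | _ , u∈′ , refl with develop-apart i d< t∈′ u∈′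
    ...   | t⋢u , u⋢t = t⋢u ∘ ⊑-rot⁻ (develop-inside i t∈′) (develop-inside (i + suc d) u∈′)
                      , u⋢t ∘ ⊑-rot⁻ (develop-inside (i + suc d) u∈′) (develop-inside i t∈′)

    develop-length : ∀ j → length (develop L j) ≡ length L
    develop-length zero    = refl
    develop-length (suc j) = trans (length-map rot₃ (develop L j)) (develop-length j)

    Starter⇒Family : Family w v (length L) (develop L)
    Starter⇒Family = record
      { inside  = λ {i} _ → All.tabulate (develop-inside i)
      ; distinct = λ {i} _ → All.tabulate (develop-distinct i)
      ; balanced = λ {i} {j} _ _ x<v y<v → trans (develop-balanced i x<v y<v) (sym (develop-balanced j x<v y<v))
      ; disjoint = λ {i} {j} i<w j<w i≢j {t} {u} t∈ u∈ → separate i j i<w j<w i≢j t∈ u∈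
      ; volume   = λ {i} _ → develop-length i
      }
      where
      gap : ∀ {i j} → i < j → j < w → ∃ λ d → d < w ∸ 1 × j ≡ i + suc d
      gap {i} {suc j} (s≤s i≤j) j<w = j ∸ i ,
        ≤-trans (s≤s (m∸n≤m j i)) (<⇒≤pred j<w) ,
        sym (trans (+-suc i (j ∸ i)) (cong suc (m+[n∸m]≡n i≤j)))
      separate : ∀ i j → i < w → j < w → i ≢ j → ∀ {t u} → t ∈ develop L i → u ∈ develop L j → ¬ t ⊑ u
      separate i j i<w j<w i≢j t∈ u∈ with <-cmp i j
      ... | tri≈ _ i≡j _ = contradiction i≡j i≢j
      ... | tri< i<j _ _ with gap i<j j<w
      ...   | d , d< , refl = proj₁ (develop-apart i d< t∈ u∈)
      separate i j i<w j<w i≢j t∈ u∈ | tri> _ _ j<i with gap j<i i<w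
      ...   | d , d< , refl = proj₂ (develop-apart j d< u∈ t∈)

open Cyclic using (Starter; starter?; develop; Starter⇒Family)

-- base3: the three perfect matchings of K₄, each joined to a point of ℤ/3; base4: a large set of group
-- divisible designs of type 2⁴; base7, base11, base17: large sets of Steiner triple systems of orders
-- 9, 13 and 19.  The last four were found by exact cover search.
base3 : List Triple
base3 =
    (0 , 3 , 4) ∷ (0 , 5 , 6) ∷ (1 , 3 , 5) ∷ (1 , 4 , 6) ∷ (2 , 3 , 6) ∷ (2 , 4 , 5) ∷ []

base3-starter : Starter 3 7 base3
base3-starter = toWitness {a? = starter? 3 7 base3} _

base4 : List Triple
base4 =
    (0 , 1 , 6) ∷ (0 , 3 , 4) ∷ (0 , 5 , 7) ∷ (1 , 2 , 5) ∷ (1 , 4 , 7) ∷ (2 , 3 , 7) ∷ (2 , 4 , 6) ∷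
    (3 , 5 , 6) ∷ []

base4-starter : Starter 4 8 base4
base4-starter = toWitness {a? = starter? 4 8 base4} _

base7 : List Triple
base7 =
    (0 , 1 , 6) ∷ (0 , 2 , 5) ∷ (0 , 3 , 4) ∷ (0 , 7 , 8) ∷ (1 , 2 , 4) ∷ (1 , 3 , 8) ∷ (1 , 5 , 7) ∷
    (2 , 3 , 7) ∷ (2 , 6 , 8) ∷ (3 , 5 , 6) ∷ (4 , 5 , 8) ∷ (4 , 6 , 7) ∷ []

base7-starter : Starter 7 9 base7
base7-starter = toWitness {a? = starter? 7 9 base7} _

base11 : List Triple
base11 =
    (0 , 1 , 4) ∷ (0 , 2 , 11) ∷ (0 , 3 , 12) ∷ (0 , 5 , 9) ∷ (0 , 6 , 8) ∷ (0 , 7 , 10) ∷ (1 , 2 , 12) ∷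
    (1 , 3 , 7) ∷ (1 , 5 , 11) ∷ (1 , 6 , 9) ∷ (1 , 8 , 10) ∷ (2 , 3 , 5) ∷ (2 , 4 , 10) ∷ (2 , 6 , 7) ∷
    (2 , 8 , 9) ∷ (3 , 4 , 9) ∷ (3 , 6 , 10) ∷ (3 , 8 , 11) ∷ (4 , 5 , 6) ∷ (4 , 7 , 11) ∷ (4 , 8 , 12) ∷
    (5 , 7 , 8) ∷ (5 , 10 , 12) ∷ (6 , 11 , 12) ∷ (7 , 9 , 12) ∷ (9 , 10 , 11) ∷ []

base11-starter : Starter 11 13 base11
base11-starter = toWitness {a? = starter? 11 13 base11} _

base17 : List Triple
base17 =
    (0 , 1 , 16) ∷ (0 , 2 , 15) ∷ (0 , 3 , 14) ∷ (0 , 4 , 13) ∷ (0 , 5 , 12) ∷ (0 , 6 , 11) ∷ (0 , 7 , 10) ∷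
    (0 , 8 , 9) ∷ (0 , 17 , 18) ∷ (1 , 2 , 12) ∷ (1 , 3 , 4) ∷ (1 , 5 , 7) ∷ (1 , 6 , 10) ∷ (1 , 8 , 18) ∷
    (1 , 9 , 15) ∷ (1 , 11 , 13) ∷ (1 , 14 , 17) ∷ (2 , 3 , 10) ∷ (2 , 4 , 11) ∷ (2 , 5 , 14) ∷ (2 , 6 , 9) ∷
    (2 , 7 , 17) ∷ (2 , 8 , 16) ∷ (2 , 13 , 18) ∷ (3 , 5 , 8) ∷ (3 , 6 , 17) ∷ (3 , 7 , 13) ∷ (3 , 9 , 11) ∷
    (3 , 12 , 15) ∷ (3 , 16 , 18) ∷ (4 , 5 , 9) ∷ (4 , 6 , 16) ∷ (4 , 7 , 8) ∷ (4 , 10 , 14) ∷ (4 , 12 , 18) ∷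
    (4 , 15 , 17) ∷ (5 , 6 , 18) ∷ (5 , 10 , 11) ∷ (5 , 13 , 17) ∷ (5 , 15 , 16) ∷ (6 , 7 , 12) ∷ (6 , 8 , 14) ∷
    (6 , 13 , 15) ∷ (7 , 9 , 18) ∷ (7 , 11 , 16) ∷ (7 , 14 , 15) ∷ (8 , 10 , 17) ∷ (8 , 11 , 15) ∷ (8 , 12 , 13) ∷
    (9 , 10 , 13) ∷ (9 , 12 , 14) ∷ (9 , 16 , 17) ∷ (10 , 12 , 16) ∷ (10 , 15 , 18) ∷ (11 , 12 , 17) ∷ (11 , 14 , 18) ∷
    (13 , 14 , 16) ∷ []

base17-starter : Starter 17 19 base17
base17-starter = toWitness {a? = starter? 17 19 base17} _

-- Small trades

-- The strict bound is the negation of what a pair in two blocks forces: `pairs-≤-volume` with pair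
-- count 2, divided by 2.
SmallTrade : ℕ → Set
SmallTrade μ = ∃₂ λ v (T : Fin μ → List (Subset v)) →
  IsMuWayTrade μ v 3 2 T × (∀ i → 3 * length (T i) < suc μ * suc (suc μ))

-- The volume is the same however many collections are used, while the bound grows with `μ`. It is
-- therefore enough to check the inequality at the least `μ` of a range, called `n`.
starter⇒smallTrade : ∀ {w v L} .{{_ : NonZero w}} → Starter w v L → 0 < length L →
  ∀ g .{{_ : NonZero g}} n → 3 * (length L * (g * g)) < suc n * suc (suc n) →
  ∀ {μ} → n ≤ μ → μ ≤ w * g → SmallTrade μ
starter⇒smallTrade {w} {v} {L} S nonempty g n small {μ} n≤μ μ≤wg =
  v * g , _ , Family⇒MuWayTrade family positive μ≤wg , λ i →
    subst (λ V → 3 * V < suc μ * suc (suc μ))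
      (sym (trans (length-map (block (v * g)) (inflate (develop w L) (toℕ i)))
                  (Family.volume family (≤-trans (toℕ<n i) μ≤wg))))
      (≤-trans small (*-mono-≤ (s≤s n≤μ) (s≤s (s≤s n≤μ))))
  where
  open Inflation g
  family : Family (w * g) (v * g) (length L * (g * g)) (inflate (develop w L))
  family = inflate-Family (Starter⇒Family w S)
  positive : 0 < length L * (g * g)
  positive = *-mono-≤ nonempty (*-mono-≤ (>-nonZero⁻¹ g) (>-nonZero⁻¹ g))

-- Put `k = μ / 7` and inflate by `g = k + 1`, so that `μ ≤ 7 * g` whatever the remainder, with
-- `n = 7 * k`. The requirement `36 (k + 1)² < (7k + 1)(7k + 2)` holds for `k ≥ 5` but fails at
-- `k = 4`, whence the threshold 35.
smallTrade-large : ∀ μ → 35 ≤ μ → SmallTrade μ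
smallTrade-large μ 35≤μ = starter⇒smallTrade base7-starter (s≤s z≤n) (suc (μ / 7)) (7 * (μ / 7))
  (subst (λ k → 3 * (12 * (suc k * suc k)) < suc (7 * k) * suc (suc (7 * k)))
    (m+[n∸m]≡n (/-monoˡ-≤ 7 35≤μ)) (quadratic (μ / 7 ∸ 5)))
  (subst (_≤ μ) (*-comm (μ / 7) 7) (m/n*n≤m μ 7))
  (begin
    μ                      ≡⟨ m≡m%n+[m/n]*n μ 7 ⟩
    μ % 7 + μ / 7 * 7      ≤⟨ +-monoˡ-≤ (μ / 7 * 7) (<⇒≤ (m%n<n μ 7)) ⟩
    suc (μ / 7) * 7        ≡⟨ *-comm (suc (μ / 7)) 7 ⟩
    7 * suc (μ / 7)        ∎)
  where
  open ≤-Reasoning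
  -- With `k = 5 + m` the gap between the two sides has only nonnegative coefficients, which proves
  -- the inequality.
  difference : ∀ m → suc (7 * (5 + m)) * suc (suc (7 * (5 + m))) ≡
    suc (3 * (12 * (suc (5 + m) * suc (5 + m)))) + (35 + 79 * m + 13 * (m * m))
  difference = solve-∀
  quadratic : ∀ m → 3 * (12 * (suc (5 + m) * suc (5 + m))) < suc (7 * (5 + m)) * suc (suc (7 * (5 + m)))
  quadratic m = subst (3 * (12 * (suc (5 + m) * suc (5 + m))) <_) (sym (difference m)) (m≤m+n _ _)

-- In each range the two numbers after the nonemptiness proof are `g` and the least `μ`, and the
-- upper end is `w * g`. In order, the checks read 18 < 20, 24 < 30, 36 < 42, 78 < 90, 171 < 182,
-- 312 < 380, 576 < 600 and 900 < 930.
smallTrade : ∀ μ → 3 ≤ μ → SmallTrade μ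
smallTrade μ 3≤μ with μ ≤? 3
... | yes μ≤3 = starter⇒smallTrade base3-starter (s≤s z≤n) 1 3 (≤ᵇ⇒≤ _ _ _) 3≤μ μ≤3
... | no μ>3 with μ ≤? 4
... | yes μ≤4 = starter⇒smallTrade base4-starter (s≤s z≤n) 1 4 (≤ᵇ⇒≤ _ _ _) (≰⇒> μ>3) μ≤4
... | no μ>4 with μ ≤? 7
... | yes μ≤7 = starter⇒smallTrade base7-starter (s≤s z≤n) 1 5 (≤ᵇ⇒≤ _ _ _) (≰⇒> μ>4) μ≤7
... | no μ>7 with μ ≤? 11
... | yes μ≤11 = starter⇒smallTrade base11-starter (s≤s z≤n) 1 8 (≤ᵇ⇒≤ _ _ _) (≰⇒> μ>7) μ≤11
... | no μ>11 with μ ≤? 17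
... | yes μ≤17 = starter⇒smallTrade base17-starter (s≤s z≤n) 1 12 (≤ᵇ⇒≤ _ _ _) (≰⇒> μ>11) μ≤17
... | no μ>17 with μ ≤? 22
... | yes μ≤22 = starter⇒smallTrade base11-starter (s≤s z≤n) 2 18 (≤ᵇ⇒≤ _ _ _) (≰⇒> μ>17) μ≤22
... | no μ>22 with μ ≤? 28
... | yes μ≤28 = starter⇒smallTrade base7-starter (s≤s z≤n) 4 23 (≤ᵇ⇒≤ _ _ _) (≰⇒> μ>22) μ≤28
... | no μ>28 with μ ≤? 35
... | yes μ≤35 = starter⇒smallTrade base7-starter (s≤s z≤n) 5 29 (≤ᵇ⇒≤ _ _ _) (≰⇒> μ>28) μ≤35
... | no μ>35 = smallTrade-large μ (<⇒≤ (≰⇒> μ>35))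

-- Comparison of the two volume bounds

another : ∀ {n} (i : Fin (2 + n)) → ∃ λ j → i ≢ j
another zero    = suc zero , λ ()
another (suc i) = zero , λ ()

theorem3p5 : (μ : ℕ) → 3 ≤ μ → (v : ℕ) (T : Fin μ → List (Subset v)) →
    IsMuWayTrade μ v 3 2 T → HasMinimumVolume μ v 3 2 T → IsSteiner μ v 2 T
theorem3p5 μ@(suc (suc _)) 3≤μ@(s≤s (s≤s _)) v T trade minimum i s ∣s∣≡2 with count s (T i) ≤? 1
... | yes ≤1 = ≤1
... | no  ≰1 with ∣s∣≡2⇒pair s ∣s∣≡2 | smallTrade μ 3≤μ
...   | x , y , x≢y , refl | v′ , T′ , trade′ , small = contradiction (begin-strict
  -- The factor 2 is the assumed failure of the Steiner property at the pair `x`, `y`. The chain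
  -- ends at the number it starts from, with one strict step.
  suc (suc μ) * (suc μ * 2)             ≤⟨ *-monoʳ-≤ (suc (suc μ)) (*-monoʳ-≤ (suc μ) (subst (2 ≤_) (count-pair x y (T i)) (≰⇒> ≰1))) ⟩
  suc (suc μ) * (suc μ * pairs x y)     ≤⟨ pairs-≤-volume x≢y ⟩
  6 * length (T i)                      ≤⟨ *-monoʳ-≤ 6 (minimum v′ T′ trade′ i i) ⟩
  6 * length (T′ i)                     ≡⟨ *-assoc 2 3 (length (T′ i)) ⟩
  2 * (3 * length (T′ i))               <⟨ *-monoʳ-< 2 (small i) ⟩
  2 * (suc μ * suc (suc μ))             ≡⟨ rearrange (suc μ) (suc (suc μ)) ⟩
  suc (suc μ) * (suc μ * 2)             ∎) (<-irrefl refl)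
  where
  open ≤-Reasoning
  -- The block size of `T i` is read off from its trade with a second index, which exists because
  -- `μ` is at least 2.
  open LowerBound T trade (λ i → proj₁ (trade i _ (proj₂ (another i)))) i
  rearrange : ∀ a b → 2 * (a * b) ≡ b * (a * 2)
  rearrange = solve-∀
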